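{- Let $d,n,j$ be integers with $n \ge 2d$ and $0 < j \le d$, and put $e = n-d$. Then $E_j(1)$ is the smallest eigenvalue of $J(n,d,j)$ (that is, $E_j(1)\le E_j(i)$ for all $0\le i\le d$) if and only if $j(n-1) \ge de$. In this case $E_j(1)$ is also the second largest in absolute value among the eigenvalues of $J(n,d,j)$ (that is, $|E_j(i)| \le |E_j(1)|$ for all $1 \le i \le d$).
   Context: For $n\ge 2d$ and $0\le j\le d$, $J(n,d,j)$ is the graph whose vertices are the $d$-subsets of a fixed $n$-set, two vertices being adjacent when they meet in exactly $d-j$ elements. Its eigenvalues are the numbers $$E_j(i) = \sum_{h=0}^j (-1)^h \binom{i}{h} \binom{d-i}{j-h} \binom{n-d-i}{j-h},\qquad 0\le i\le d,$$ and $E_j(0)=\binom{d}{j}\binom{n-d}{j}$ is the valency (the largest eigenvalue). -}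

module Defs where

open import Data.Fin.Base using (toℕ)
open import Data.Integer.Base using (ℤ; +_; -1ℤ; _*_; _^_; _≤_; ∣_∣)
open import Data.Integer.Properties using (+-*-semiring)
open import Data.Nat.Base as ℕ using (ℕ; _∸_)
open import Data.Nat.Combinatorics using (_C_)
open import Algebra.Properties.Semiring.Sum +-*-semiring using (sum⁺-syntax)

-- The eigenvalue E_j(i) of J(n,d,j), for 2d ≤ n, j ≤ d and i ≤ d.
-- In that range no truncated subtraction below is truncated;
-- m C k is 0 when k exceeds m.
E : (n d j i : ℕ) → ℤ
E n d j i = ∑[ h ≤ j ] (-1ℤ ^ toℕ h
                        * + (i C toℕ h)
                        * + ((d ∸ i) C (j ∸ toℕ h))
                        * + ((n ∸ d ∸ i) C (j ∸ toℕ h)))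

E₁-IsSmallest : (n d j : ℕ) → Set
E₁-IsSmallest n d j = ∀ i → i ℕ.≤ d → E n d j 1 ≤ E n d j i

-- The valency E_j(0) is the largest absolute value, so i = 0 is excluded.
E₁-IsSecondLargestInAbs : (n d j : ℕ) → Set
E₁-IsSecondLargestInAbs n d j =
  ∀ i → 1 ℕ.≤ i → i ℕ.≤ d → ∣ E n d j i ∣ ℕ.≤ ∣ E n d j 1 ∣

-- Put e = n - d and w = C(d,j) C(e,j).  Since E_j(i) is the coefficient of x^j in
-- (1 - x)^i Σ C(d-i,k) C(e-i,k) x^k, it is the difference of the eigenvalues E_j(i-1) and
-- E_{j-1}(i-1) belonging to (d-1, e-1).  Let s = d e - j (n-1) = (d-j)(e-j) - j (j-1), so that
-- the condition of the theorem is s ≤ 0.  Then d e E_j(1) = (s - j) w, and E_j(2) - E_j(1) is a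
-- negative multiple of s; comparing the two gives "only if".
--
-- Conversely, |E_j(i)| ≤ - E_j(1) follows from s ≤ 0 by induction on i with the triangle
-- inequality.  If s ≤ - 2 (j-1), the condition is inherited by both (d-1, e-1, j) and
-- (d-1, e-1, j-1).  In the critical strip - 2 (j-1) < s ≤ 0 one uses instead the bound
-- |E_j(i)| ≤ w (2 s² + 3 j² (n-1)) / (2 d² e²), which holds for all i ≥ 2 and all j apart from
-- three small cases with j = 1.  It is proved by the same recursion; near s = 0 the weights of
-- the two terms add up to about 2 d e / n² ≤ 1/2, which leaves room for the error terms.
module Submission where

open import Data.Empty using (⊥)
open import Data.Fin.Base using (Fin; toℕ)
open import Data.Integer.Base
  using (ℤ; +_; -[1+_]; 0ℤ; 1ℤ; -1ℤ; _+_; _*_; _-_; -_; _^_; _≤_; _<_; ∣_∣; positive; +≤+; -≤+)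
open import Data.Integer.Properties as ℤ using (+-*-semiring; pos-*)
open import Data.Integer.Tactic.RingSolver using (solve-∀)
open import Data.Nat.Base as ℕ using (ℕ; zero; suc; _∸_; _≥_)
open import Data.Nat.Combinatorics using (_C_; nCk+nC[k+1]≡[n+1]C[k+1]; k>n⇒nCk≡0; nCn≡1; nC1≡n)
import Data.Nat.Properties as ℕ
open import Data.Product.Base using (_×_; _,_)
open import Data.Sum.Base using (_⊎_; inj₁; inj₂)
open import Function.Bundles using (_⇔_; mk⇔)
open import Relation.Binary.PropositionalEquality
  using (_≡_; refl; sym; trans; cong; cong₂; subst; subst₂; module ≡-Reasoning)
open import Relation.Nullary.Decidable using (Dec; from-yes; yes; no)
open import Relation.Nullary.Negation using (contradiction)
open import Defs
open import Algebra.Properties.Semiring.Sum +-*-semiring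
  using (sum; sum⁺-syntax; ∑-distrib-+; sum-cong-≗; sum-replicate-zero)

-- In the critical strip the term E_{j-1}(i-1) belongs to the parameter s + 2 (j-1) > 0, for which
-- the hypothesis of the theorem is lost. The auxiliary bound therefore has to survive the recursion
-- for either sign of s. Its shape comes from i = 2: with N = n - 1 one has d e (d-1)(e-1) E_j(2) =
-- (s² - s N - j (j-1) N) w, a main term s² and, near s = 0, an error of order j² N.
--
-- All bounds are multiplied by their denominators and become polynomial inequalities over the
-- integers. With a = d - j and b = e - j, the parameters satisfy m + 1 = a + b and s + j (j-1) = a
-- b. The estimates rest mainly on a b ≥ a + b - 1 for a, b ≥ 1 and on 4 a b ≤ (a + b)²; integrality
-- turns the latter into a linear lower bound for m. The variables of each certificate are shifted
-- by such lower bounds, which makes most coefficients nonnegative; the remaining terms are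
-- completed squares or multiples of a hypothesis.

-- The coefficient of x^k in (1 - x)^i Σ C(c,l) C(f,l) x^l; for c = d - i and f = e - i
-- it is the eigenvalue E_k(i).
T : (c f i k : ℕ) → ℤ
T c f zero    k       = + (c C k) * + (f C k)
T c f (suc i) zero    = T c f i zero
T c f (suc i) (suc k) = T c f i (suc k) - T c f i k

-- The alternating sum satisfies the recursion

term : (c f i k h : ℕ) → ℤ
term c f i k h = -1ℤ ^ h * + (i C h) * + (c C (k ∸ h)) * + (f C (k ∸ h))

Alt : (c f i k : ℕ) → ℤ
Alt c f i k = ∑[ h ≤ k ] term c f i k (toℕ h)

-- Pascal's rule in `i C h`. Raising h and k together preserves k - h, so the factors in c and f
-- agree and only signs and `i C h` differ.
term-pascal : ∀ c f i k h →
  term c f (suc i) (suc k) (suc h) + term c f i k h ≡ term c f i (suc k) (suc h)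
term-pascal c f i k h rewrite sym (nCk+nC[k+1]≡[n+1]C[k+1] i h) =
  lemma (-1ℤ ^ h) (+ (i C h)) (+ (i C suc h)) (+ (c C (k ∸ h))) (+ (f C (k ∸ h)))
  where
  lemma : ∀ σ u v x y → -1ℤ * σ * (u + v) * x * y + σ * u * x * y ≡ -1ℤ * σ * v * x * y
  lemma = solve-∀

Alt≡T : ∀ c f i k → Alt c f i k ≡ T c f i k
Alt≡T c f zero k = begin
  term c f 0 k 0 + sum {k} (λ h → term c f 0 k (suc (toℕ h)))
    ≡⟨ cong₂ _+_ (1*1*x*y (+ (c C k)) (+ (f C k)))
                   (sum-cong-≗ {k} λ h → x*0*y*z (-1ℤ ^ suc (toℕ h)) (+ (c C (k ∸ suc (toℕ h))))
                       (+ (f C (k ∸ suc (toℕ h))))) ⟩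
  + (c C k) * + (f C k) + sum {k} (λ _ → 0ℤ)
    ≡⟨ cong (λ z → + (c C k) * + (f C k) + z) (sum-replicate-zero k) ⟩
  + (c C k) * + (f C k) + 0ℤ
    ≡⟨ ℤ.+-identityʳ _ ⟩
  T c f zero k ∎
  where
  open ≡-Reasoning
  1*1*x*y : ∀ x y → 1ℤ * 1ℤ * x * y ≡ x * y
  1*1*x*y = solve-∀
  x*0*y*z : ∀ x y z → x * 0ℤ * y * z ≡ 0ℤ
  x*0*y*z = solve-∀
Alt≡T c f (suc i) zero    = Alt≡T c f i zero
Alt≡T c f (suc i) (suc k) = begin
  Alt c f (suc i) (suc k)
    -- Adding and removing the lower sum lets `term-pascal` act termwise; the summand h = 0 is the
    -- same for i and `suc i`.
    ≡⟨ x≡x+y-y _ (Alt c f i k) ⟩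
  (t₀ + sum u + sum v) - sum v
    ≡⟨ cong (_- sum v) (trans (ℤ.+-assoc t₀ _ _) (cong (λ z → t₀ + z) (sym (∑-distrib-+ u v)))) ⟩
  (t₀ + sum (λ h → u h + v h)) - sum v
    ≡⟨ cong (λ z → (t₀ + z) - sum v) (sum-cong-≗ {suc k} (λ h → term-pascal c f i k (toℕ h))) ⟩
  Alt c f i (suc k) - Alt c f i k
    ≡⟨ cong₂ _-_ (Alt≡T c f i (suc k)) (Alt≡T c f i k) ⟩
  T c f (suc i) (suc k) ∎
  where
  open ≡-Reasoning
  t₀ = term c f (suc i) (suc k) 0
  u v : Fin (suc k) → ℤ
  u h = term c f (suc i) (suc k) (suc (toℕ h))
  v h = term c f i k (toℕ h)
  x≡x+y-y : ∀ x y → x ≡ (x + y) - y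
  x≡x+y-y = solve-∀

E≡T : ∀ n d j i → E n d j i ≡ T (d ∸ i) (n ∸ d ∸ i) i j
E≡T n d j i = Alt≡T (d ∸ i) (n ∸ d ∸ i) i j

-- Vanishing, small values, and absorption for binomials

k>c+i⇒T≡0 : ∀ c f i {k} → k ℕ.> i ℕ.+ c → T c f i k ≡ 0ℤ
k>c+i⇒T≡0 c f zero    k>c rewrite k>n⇒nCk≡0 k>c = refl
k>c+i⇒T≡0 c f (suc i) {suc k} (ℕ.s≤s k>i+c)
  rewrite k>c+i⇒T≡0 c f i (ℕ.m<n⇒m<1+n k>i+c) | k>c+i⇒T≡0 c f i k>i+c = refl

T-zero : ∀ c f i → T c f i 0 ≡ 1ℤ
T-zero c f zero    = refl
T-zero c f (suc i) = T-zero c f i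

T-one : ∀ c f i → T c f i 1 ≡ + c * + f - + i
T-one c f zero rewrite nC1≡n c | nC1≡n f = sym (ℤ.+-identityʳ _)
T-one c f (suc i) rewrite T-one c f i | T-zero c f i = lemma (+ c * + f) (+ i)
  where
  lemma : ∀ x y → x - y - 1ℤ ≡ x - (1ℤ + y)
  lemma = solve-∀

absorb : ∀ n k → suc k ℕ.* (suc n C suc k) ≡ suc n ℕ.* (n C k)
absorb n zero = begin
  1 ℕ.* (suc n C 1)   ≡⟨ ℕ.*-identityˡ _ ⟩
  suc n C 1           ≡⟨ nC1≡n (suc n) ⟩
  suc n               ≡⟨ ℕ.*-identityʳ (suc n) ⟨
  suc n ℕ.* 1         ∎
  where open ≡-Reasoning
absorb zero (suc k) = ℕ.*-zeroʳ (suc (suc k))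
absorb (suc n) (suc k)
  rewrite sym (nCk+nC[k+1]≡[n+1]C[k+1] (suc n) (suc k)) = begin
  suc (suc k) ℕ.* (x ℕ.+ (suc n C suc (suc k)))
    ≡⟨ ℕ.*-distribˡ-+ (suc (suc k)) x _ ⟩
  suc (suc k) ℕ.* x ℕ.+ suc (suc k) ℕ.* (suc n C suc (suc k))
    ≡⟨ cong₂ (λ y z → x ℕ.+ y ℕ.+ z) (absorb n k) (absorb n (suc k)) ⟩
  x ℕ.+ suc n ℕ.* (n C k) ℕ.+ suc n ℕ.* (n C suc k)
    ≡⟨ ℕ.+-assoc x _ _ ⟩
  x ℕ.+ (suc n ℕ.* (n C k) ℕ.+ suc n ℕ.* (n C suc k))
    ≡⟨ cong (x ℕ.+_) (ℕ.*-distribˡ-+ (suc n) (n C k) _) ⟨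
  x ℕ.+ suc n ℕ.* (n C k ℕ.+ n C suc k)
    ≡⟨ cong (λ y → x ℕ.+ suc n ℕ.* y) (nCk+nC[k+1]≡[n+1]C[k+1] n k) ⟩
  suc (suc n) ℕ.* x ∎
  where
  open ≡-Reasoning
  x = suc n C suc k

absorbℤ : ∀ n k → (1ℤ + + n) * + (n C k) ≡ (1ℤ + + k) * + (suc n C suc k)
absorbℤ n k = begin
  + suc n * + (n C k)            ≡⟨ pos-* (suc n) (n C k) ⟨
  + (suc n ℕ.* (n C k))          ≡⟨ cong +_ (absorb n k) ⟨
  + (suc k ℕ.* (suc n C suc k))  ≡⟨ pos-* (suc k) (suc n C suc k) ⟩
  + suc k * + (suc n C suc k)    ∎
  where open ≡-Reasoning

-- Pascal's rule minus absorption. The factor is an integer difference, so nothing is truncated when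
-- k exceeds n.
co-absorbℤ : ∀ n k → (1ℤ + + n) * + (n C suc k) ≡ ((1ℤ + + n) - (1ℤ + + k)) * + (suc n C suc k)
co-absorbℤ n k = begin
  (1ℤ + + n) * + (n C suc k)
    ≡⟨ lemma (1ℤ + + n) (+ (n C k)) (+ (n C suc k)) ⟩
  (1ℤ + + n) * (+ (n C k) + + (n C suc k)) - (1ℤ + + n) * + (n C k)
    ≡⟨ cong₂ (λ y z → (1ℤ + + n) * + y - z) (nCk+nC[k+1]≡[n+1]C[k+1] n k) (absorbℤ n k) ⟩
  (1ℤ + + n) * w - (1ℤ + + k) * w
    ≡⟨ lemma′ (1ℤ + + n) (1ℤ + + k) w ⟩
  ((1ℤ + + n) - (1ℤ + + k)) * w ∎
  where
  open ≡-Reasoning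
  w = + (suc n C suc k)
  lemma : ∀ m x y → m * y ≡ m * (x + y) - m * x
  lemma = solve-∀
  lemma′ : ∀ m k w → m * w - k * w ≡ (m - k) * w
  lemma′ = solve-∀

-- Polynomial inequalities, each certified by an explicit sum of nonnegative terms

infixl 6 _⊕_
infixl 7 _⊗_

_⊕_ : ∀ {x y} → 0ℤ ≤ x → 0ℤ ≤ y → 0ℤ ≤ x + y
_⊕_ = ℤ.+-mono-≤

_⊗_ : ∀ {x y} → 0ℤ ≤ x → 0ℤ ≤ y → 0ℤ ≤ x * y
_⊗_ {+ m} {+ n} _ _ = subst (0ℤ ≤_) (pos-* m n) (+≤+ ℕ.z≤n)

lit : ∀ n → 0ℤ ≤ + n
lit n = +≤+ ℕ.z≤n

square : ∀ x → 0ℤ ≤ x * x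
square (+ n)      = lit n ⊗ lit n
square -[1+ n ] = lit _

by-nonneg : ∀ {x y z} → y - x ≡ z → 0ℤ ≤ z → x ≤ y
by-nonneg eq 0≤z = ℤ.0≤i-j⇒j≤i (subst (0ℤ ≤_) (sym eq) 0≤z)

-- Below N = n - 1, m = N - 2 j, s + j (j - 1) = (d - j)(e - j), s + j N = d e and
-- s + (j - 1) N = (d - 1)(e - 1).  Then quad is 2 (d e)² times the bound on |E_j(i)| / w
-- for i ≥ 2.  The coefficient 3 has to be large enough for i = 2 and small enough for the
-- critical strip.
quad : (s N j : ℤ) → ℤ
quad s N j = + 2 * (s * s) + + 3 * (j * j) * N

-- The two values of quad are those of (d - 1, e - 1, j) and (d - 1, e - 1, j - 1).
children : (s m j : ℤ) → ℤ
children s m j = (s + j * (j - 1ℤ)) * quad (s - m) (m + + 2 * j - + 2) j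
               + j * j * quad (s + + 2 * (j - 1ℤ)) (m + + 2 * j - + 2) (j - 1ℤ)

-- What remains of the induction step for the bound once valencies are cancelled: the factors are d
-- e on the left and the square of (d - 1)(e - 1) on the right.
Contracts : (s m j : ℤ) → Set
Contracts s m j = (s + j * N) * children s m j ≤ (s + (j - 1ℤ) * N) * (s + (j - 1ℤ) * N) * quad s N j
  where N = m + + 2 * j

-- The case s ≤ 0, with m and j measured from 1 and 2. The last hypothesis is (d - j)(e - j) ≥ 0.
contract-below : ∀ S u J → 0ℤ ≤ S → 0ℤ ≤ u → 0ℤ ≤ J → 0ℤ ≤ (+ 2 + J) * (+ 2 + J - 1ℤ) - S →
  let j = + 2 + J
      m = 1ℤ + u
      s = - S
      N = m + + 2 * j in
  j * j * children s m j ≤ (j - 1ℤ) * (s * (j + 1ℤ) + j * N * (j - 1ℤ)) * quad s N j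
contract-below S u J S≥0 u≥0 J≥0 p≥0 = by-nonneg (identity S u J) (
  lit 2 ⊗ m≥0 ⊗ (j≥0 ⊗ j≥0 ⊗ j≥0) ⊗ square (S - (+ 1 + J))
  ⊕ j≥0 ⊗ j≥0 ⊗ j≥0 ⊗ (lit 1 ⊕ J≥0) ⊗ J≥0 ⊗ (lit 4 ⊗ J≥0 ⊕ lit 7)
  ⊕ u≥0 ⊗ (j≥0 ⊗ j≥0 ⊗ j≥0) ⊗ (lit 1 ⊕ J≥0) ⊗ (lit 6 ⊗ (J≥0 ⊗ J≥0) ⊕ lit 13 ⊗ J≥0 ⊕ lit 4)
  ⊕ m≥0 ⊗ m≥0 ⊗ (j≥0 ⊗ j≥0 ⊗ j≥0) ⊗ (lit 1 ⊕ J≥0) ⊗ (lit 3 ⊗ J≥0 ⊕ lit 1)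
  ⊕ lit 2 ⊗ (m≥0 ⊗ m≥0) ⊗ (j≥0 ⊗ j≥0) ⊗ S≥0 ⊕ lit 3 ⊗ m≥0 ⊗ (j≥0 ⊗ j≥0) ⊗ S≥0
  ⊕ lit 2 ⊗ (j≥0 ⊗ j≥0) ⊗ (lit 4 ⊗ J≥0 ⊕ lit 5) ⊗ S≥0 ⊗ p≥0
  ⊕ lit 2 ⊗ (j≥0 ⊗ j≥0) ⊗ (lit 1 ⊕ J≥0) ⊗ (S≥0 ⊗ S≥0) ⊕ lit 2 ⊗ m≥0 ⊗ j≥0 ⊗ (S≥0 ⊗ S≥0)
  ⊕ lit 2 ⊗ (S≥0 ⊗ S≥0 ⊗ S≥0))
  where
  m≥0 = lit 1 ⊕ u≥0
  j≥0 = lit 2 ⊕ J≥0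
  identity : ∀ S u J →
    let j = + 2 + J
        m = 1ℤ + u
        s = - S
        N = m + + 2 * j
        M = + 2 * (s * s) + + 3 * (j * j) * N
        M′ = + 2 * ((s - m) * (s - m)) + + 3 * (j * j) * (N - + 2)
        M″ = + 2 * ((s + + 2 * (j - 1ℤ)) * (s + + 2 * (j - 1ℤ)))
                + + 3 * ((j - 1ℤ) * (j - 1ℤ)) * (N - + 2)
        L = (s + j * (j - 1ℤ)) * M′ + j * j * M″
        Y = (j - 1ℤ) * (s * (j + 1ℤ) + j * N * (j - 1ℤ)) in
    Y * M - j * j * L
    ≡ + 2 * m * (j * j * j) * ((S - (+ 1 + J)) * (S - (+ 1 + J)))
      + j * j * j * (+ 1 + J) * J * (+ 4 * J + + 7)
      + u * (j * j * j) * (+ 1 + J) * (+ 6 * (J * J) + + 13 * J + + 4)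
      + m * m * (j * j * j) * (+ 1 + J) * (+ 3 * J + + 1) + + 2 * (m * m) * (j * j) * S
      + + 3 * m * (j * j) * S + + 2 * (j * j) * (+ 4 * J + + 5) * S * (j * (j - + 1) - S)
      + + 2 * (j * j) * (+ 1 + J) * (S * S) + + 2 * m * j * (S * S) + + 2 * (S * S * S)
  identity = solve-∀

-- The boundary d = j, where (d - j)(e - j) = 0 and only the second child contributes. Here m may be
-- 0, which `contract-below` excludes.
contract-edge : ∀ u J → 0ℤ ≤ u → 0ℤ ≤ J →
  let j = + 2 + J
      m = u
      s = - (j * (j - 1ℤ))
      N = m + + 2 * j in
  j * j * children s m j ≤ (j - 1ℤ) * (s * (j + 1ℤ) + j * N * (j - 1ℤ)) * quad s N j
contract-edge u J u≥0 J≥0 = by-nonneg (identity u J) (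
  (lit 3 ⊗ J≥0 ⊗ J≥0 ⊗ J≥0 ⊗ J≥0 ⊗ J≥0 ⊕ lit 24 ⊗ J≥0 ⊗ J≥0 ⊗ J≥0 ⊗ J≥0 ⊕ lit 75 ⊗ J≥0 ⊗ J≥0 ⊗ J≥0
          ⊕ lit 114 ⊗ J≥0 ⊗ J≥0 ⊕ lit 84 ⊗ J≥0 ⊕ lit 24) ⊗ u≥0 ⊗ u≥0
  ⊕ (lit 2 ⊗ J≥0 ⊗ J≥0 ⊗ J≥0 ⊗ J≥0 ⊗ J≥0 ⊗ J≥0 ⊗ J≥0 ⊕ lit 26 ⊗ J≥0 ⊗ J≥0 ⊗ J≥0 ⊗ J≥0 ⊗ J≥0 ⊗ J≥0
          ⊕ lit 141 ⊗ J≥0 ⊗ J≥0 ⊗ J≥0 ⊗ J≥0 ⊗ J≥0 ⊕ lit 414 ⊗ J≥0 ⊗ J≥0 ⊗ J≥0 ⊗ J≥0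
                  ⊕ lit 711 ⊗ J≥0 ⊗ J≥0 ⊗ J≥0 ⊕ lit 714 ⊗ J≥0 ⊗ J≥0 ⊕ lit 388 ⊗ J≥0 ⊕ lit 88) ⊗ u≥0
  ⊕ lit 2 ⊗ J≥0 ⊗ J≥0 ⊗ J≥0 ⊗ J≥0 ⊗ J≥0 ⊗ J≥0 ⊗ J≥0 ⊕ lit 22 ⊗ J≥0 ⊗ J≥0 ⊗ J≥0 ⊗ J≥0 ⊗ J≥0 ⊗ J≥0
  ⊕ lit 100 ⊗ J≥0 ⊗ J≥0 ⊗ J≥0 ⊗ J≥0 ⊗ J≥0 ⊕ lit 242 ⊗ J≥0 ⊗ J≥0 ⊗ J≥0 ⊗ J≥0
  ⊕ lit 334 ⊗ J≥0 ⊗ J≥0 ⊗ J≥0 ⊕ lit 260 ⊗ J≥0 ⊗ J≥0 ⊕ lit 104 ⊗ J≥0 ⊕ lit 16)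
  where
  identity : ∀ u J →
    let j = + 2 + J
        m = u
        s = - (j * (j - 1ℤ))
        N = m + + 2 * j
        M = + 2 * (s * s) + + 3 * (j * j) * N
        M′ = + 2 * ((s - m) * (s - m)) + + 3 * (j * j) * (N - + 2)
        M″ = + 2 * ((s + + 2 * (j - 1ℤ)) * (s + + 2 * (j - 1ℤ)))
                + + 3 * ((j - 1ℤ) * (j - 1ℤ)) * (N - + 2)
        L = (s + j * (j - 1ℤ)) * M′ + j * j * M″
        Y = (j - 1ℤ) * (s * (j + 1ℤ) + j * N * (j - 1ℤ)) in
    Y * M - j * j * L
    ≡ (+ 3 * J * J * J * J * J + + 24 * J * J * J * J + + 75 * J * J * J + + 114 * J * J + + 84 * J
            + + 24) * u * u
      + (+ 2 * J * J * J * J * J * J * J + + 26 * J * J * J * J * J * J + + 141 * J * J * J * J * J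
              + + 414 * J * J * J * J + + 711 * J * J * J + + 714 * J * J + + 388 * J + + 88) * u
      + + 2 * J * J * J * J * J * J * J + + 22 * J * J * J * J * J * J
      + + 100 * J * J * J * J * J + + 242 * J * J * J * J + + 334 * J * J * J + + 260 * J * J
      + + 104 * J + + 16
  identity = solve-∀

-- Used for s > 0 and j ≥ 3. The start m = 2 j - 1 comes from the inequality of the means; the last
-- hypothesis is m ≤ (d - j)(e - j).
contract-above : ∀ s u J → 0ℤ ≤ s → 0ℤ ≤ u → 0ℤ ≤ J → 0ℤ ≤ s + (+ 3 + J) * (+ 3 + J - 1ℤ)
        - (+ 5 + + 2 * J + u) →
  let j = + 3 + J
      m = + 5 + + 2 * J + u
      N = m + + 2 * j in
  children s m j ≤ (s + j * N - + 2 * N) * quad s N j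
contract-above s u J s≥0 u≥0 J≥0 ρ≥0 = by-nonneg (identity s u J) (
  lit 2 ⊗ m≥0 ⊗ s≥0 ⊗ ρ≥0
  ⊕ (lit 4 ⊗ (J≥0 ⊗ J≥0) ⊕ lit 12 ⊗ J≥0 ⊕ lit 2) ⊗ square (s - (J + + 8))
  ⊕ (lit 2 ⊗ J≥0 ⊕ lit 4) ⊗ s≥0 ⊗ s≥0 ⊗ u≥0
  ⊕ (lit 2 ⊗ J≥0 ⊗ J≥0 ⊕ lit 10 ⊗ J≥0 ⊕ lit 12) ⊗ s≥0 ⊗ u≥0
  ⊕ (lit 4 ⊗ J≥0 ⊗ J≥0 ⊗ J≥0 ⊕ lit 60 ⊗ J≥0 ⊗ J≥0 ⊕ lit 138 ⊗ J≥0 ⊕ lit 2) ⊗ s≥0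
  ⊕ (lit 3 ⊗ J≥0 ⊗ J≥0 ⊗ J≥0 ⊕ lit 19 ⊗ J≥0 ⊗ J≥0 ⊕ lit 35 ⊗ J≥0 ⊕ lit 15) ⊗ u≥0 ⊗ u≥0
  ⊕ (lit 18 ⊗ J≥0 ⊗ J≥0 ⊗ J≥0 ⊗ J≥0 ⊕ lit 163 ⊗ J≥0 ⊗ J≥0 ⊗ J≥0 ⊕ lit 516 ⊗ J≥0 ⊗ J≥0 ⊕ lit 635 ⊗ J≥0
          ⊕ lit 204) ⊗ u≥0
  ⊕ lit 24 ⊗ J≥0 ⊗ J≥0 ⊗ J≥0 ⊗ J≥0 ⊗ J≥0 ⊕ lit 274 ⊗ J≥0 ⊗ J≥0 ⊗ J≥0 ⊗ J≥0
  ⊕ lit 1144 ⊗ J≥0 ⊗ J≥0 ⊗ J≥0 ⊕ lit 1983 ⊗ J≥0 ⊗ J≥0 ⊕ lit 1164 ⊗ J≥0 ⊕ lit 121)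
  where
  m≥0 = lit 5 ⊕ lit 2 ⊗ J≥0 ⊕ u≥0
  identity : ∀ s u J →
    let j = + 3 + J
        m = + 5 + + 2 * J + u
        N = m + + 2 * j
        M = + 2 * (s * s) + + 3 * (j * j) * N
        M′ = + 2 * ((s - m) * (s - m)) + + 3 * (j * j) * (N - + 2)
        M″ = + 2 * ((s + + 2 * (j - 1ℤ)) * (s + + 2 * (j - 1ℤ)))
                + + 3 * ((j - 1ℤ) * (j - 1ℤ)) * (N - + 2)
        L = (s + j * (j - 1ℤ)) * M′ + j * j * M″ in
    (s + j * N - + 2 * N) * M - L
    ≡ + 2 * m * s * (s + j * (j - + 1) - m)
      + (+ 4 * (J * J) + + 12 * J + + 2) * ((s - (J + + 8)) * (s - (J + + 8)))
      + (+ 2 * J + + 4) * s * s * u + (+ 2 * J * J + + 10 * J + + 12) * s * u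
      + (+ 4 * J * J * J + + 60 * J * J + + 138 * J + + 2) * s
      + (+ 3 * J * J * J + + 19 * J * J + + 35 * J + + 15) * u * u
      + (+ 18 * J * J * J * J + + 163 * J * J * J + + 516 * J * J + + 635 * J + + 204) * u
      + + 24 * J * J * J * J * J + + 274 * J * J * J * J + + 1144 * J * J * J + + 1983 * J * J
      + + 1164 * J + + 121
  identity = solve-∀

-- For j = 2 the factor D - 2 N is just s and too small: s = 1, m = 3 gives 336 on the left against
-- 86. Hence the full inequality is certified.
contract-above-two : ∀ s u → 0ℤ ≤ s → 0ℤ ≤ u → 0ℤ ≤ s - 1ℤ - u →
  Contracts s (+ 3 + u) (+ 2)
contract-above-two s u s≥0 u≥0 ρ≥0 = by-nonneg (identity s u) (
  lit 4 ⊗ (u≥0 ⊗ u≥0) ⊗ s≥0 ⊗ ρ≥0 ⊕ lit 36 ⊗ u≥0 ⊗ s≥0 ⊗ ρ≥0 ⊕ lit 44 ⊗ u≥0 ⊗ square (s - + 1)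
  ⊕ lit 96 ⊗ square (s - + 2) ⊕ lit 4 ⊗ s≥0 ⊗ s≥0 ⊗ s≥0 ⊗ u≥0 ⊕ lit 4 ⊗ s≥0 ⊗ s≥0 ⊗ u≥0 ⊗ u≥0
  ⊕ lit 4 ⊗ s≥0 ⊗ u≥0 ⊕ lit 108 ⊗ s≥0 ⊕ lit 4 ⊗ u≥0 ⊗ u≥0 ⊗ u≥0 ⊕ lit 76 ⊗ u≥0 ⊗ u≥0
  ⊕ lit 384 ⊗ u≥0 ⊕ lit 260)
  where
  identity : ∀ s u →
    let j = + 2
        m = + 3 + u
        N = m + + 2 * j
        M = + 2 * (s * s) + + 3 * (j * j) * N
        M′ = + 2 * ((s - m) * (s - m)) + + 3 * (j * j) * (N - + 2)
        M″ = + 2 * ((s + + 2 * (j - 1ℤ)) * (s + + 2 * (j - 1ℤ)))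
                + + 3 * ((j - 1ℤ) * (j - 1ℤ)) * (N - + 2)
        L = (s + j * (j - 1ℤ)) * M′ + j * j * M″ in
    (s + (j - 1ℤ) * N) * (s + (j - 1ℤ) * N) * M - (s + j * N) * L
    ≡ + 4 * (u * u) * s * (s - + 1 - u) + + 36 * u * s * (s - + 1 - u)
      + + 44 * u * ((s - + 1) * (s - + 1)) + + 96 * ((s - + 2) * (s - + 2))
      + + 4 * s * s * s * u + + 4 * s * s * u * u + + 4 * s * u + + 108 * s + + 4 * u * u * u
      + + 76 * u * u + + 384 * u + + 260
  identity = solve-∀

-- d e (d - 1)(e - 1) E_j(2) = second · w.
second : (s m j : ℤ) → ℤ
second s m j = (s + j * (j - 1ℤ)) * (s + j * (j - 1ℤ) - m) - + 2 * (s + j * (j - 1ℤ)) * (j * j)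
             + j * j * ((j - 1ℤ) * (j - 1ℤ))

-- E_j(2) against the window bound

second-upper-above : ∀ s u J → 0ℤ ≤ s → 0ℤ ≤ u → 0ℤ ≤ J →
  let j = + 2 + J
      m = u - 1ℤ
      N = m + + 2 * j in
  + 2 * (s + j * N) * second s m j ≤ (s + (j - 1ℤ) * N) * quad s N j
second-upper-above s u J s≥0 u≥0 J≥0 = by-nonneg (identity s u J) (
  lit 5 ⊗ (j≥0 ⊗ j≥0) ⊗ (s≥0 ⊕ (lit 1 ⊕ J≥0) ⊗ (lit 3 ⊕ lit 2 ⊗ J≥0 ⊕ u≥0)) ⊗ (lit 3 ⊕ lit 2 ⊗ J≥0
          ⊕ u≥0)
  ⊕ lit 2 ⊗ (lit 3 ⊕ lit 2 ⊗ J≥0 ⊕ u≥0) ⊗ (lit 2 ⊕ lit 2 ⊗ J≥0 ⊕ u≥0) ⊗ j≥0 ⊗ s≥0)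
  where
  j≥0 = lit 2 ⊕ J≥0
  identity : ∀ s u J →
    let j = + 2 + J
        m = u - 1ℤ
        N = m + + 2 * j
        U = (s + j * (j - 1ℤ)) * (s + j * (j - 1ℤ) - m) - + 2 * (s + j * (j - 1ℤ)) * (j * j)
                + j * j * ((j - 1ℤ) * (j - 1ℤ))
        D = s + j * N
        x = s + (j - 1ℤ) * N
        M = + 2 * (s * s) + + 3 * (j * j) * N in
    x * M - + 2 * D * U
    ≡ + 5 * (j * j) * (s + (+ 1 + J) * (+ 3 + + 2 * J + u)) * (+ 3 + + 2 * J + u)
      + + 2 * (+ 3 + + 2 * J + u) * (+ 2 + + 2 * J + u) * j * s
  identity = solve-∀

second-upper-below : ∀ S u J → 0ℤ ≤ S → 0ℤ ≤ u → 0ℤ ≤ J → 0ℤ ≤ (+ 2 + J) * (1ℤ + J) - S →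
  let j = + 2 + J
      m = u - 1ℤ
      s = - S
      N = m + + 2 * j in
  + 2 * (s + j * N) * second s m j ≤ (s + (j - 1ℤ) * N) * quad s N j
second-upper-below S u J S≥0 u≥0 J≥0 p≥0 = by-nonneg (identity S u J) (
  j≥0 ⊗ (lit 3 ⊕ lit 2 ⊗ J≥0 ⊕ u≥0) ⊗ (lit 5 ⊗ (lit 3 ⊕ lit 2 ⊗ J≥0 ⊕ u≥0) ⊗ p≥0
          ⊕ S≥0 ⊗ (lit 1 ⊕ J≥0 ⊕ lit 3 ⊗ u≥0)))
  where
  j≥0 = lit 2 ⊕ J≥0
  identity : ∀ S u J →
    let j = + 2 + J
        m = u - 1ℤ
        s = - S
        N = m + + 2 * j
        U = (s + j * (j - 1ℤ)) * (s + j * (j - 1ℤ) - m) - + 2 * (s + j * (j - 1ℤ)) * (j * j)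
                + j * j * ((j - 1ℤ) * (j - 1ℤ))
        D = s + j * N
        x = s + (j - 1ℤ) * N
        M = + 2 * (s * s) + + 3 * (j * j) * N in
    x * M - + 2 * D * U
    ≡ j * (+ 3 + + 2 * J + u) * (+ 5 * (+ 3 + + 2 * J + u) * (j * (+ 1 + J) - S)
            + S * (+ 1 + J + + 3 * u))
  identity = solve-∀

second-lower-below : ∀ S u J → 0ℤ ≤ S → 0ℤ ≤ u → 0ℤ ≤ J → 0ℤ ≤ - S
        + (+ 2 + J - 1ℤ) * (u - 1ℤ + + 2 * (+ 2 + J)) →
  let j = + 2 + J
      m = u - 1ℤ
      s = - S
      N = m + + 2 * j in
  - (+ 2 * (s + j * N) * second s m j) ≤ (s + (j - 1ℤ) * N) * quad s N j
second-lower-below S u J S≥0 u≥0 J≥0 x≥0 = by-nonneg (identity S u J) (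
  x≥0 ⊗ (lit 4 ⊗ (S≥0 ⊗ S≥0) ⊕ j≥0 ⊗ j≥0 ⊗ (lit 3 ⊕ lit 2 ⊗ J≥0 ⊕ u≥0))
  ⊕ lit 2 ⊗ (lit 3 ⊕ lit 2 ⊗ J≥0 ⊕ u≥0) ⊗ (lit 2 ⊕ lit 2 ⊗ J≥0 ⊕ u≥0) ⊗ j≥0 ⊗ S≥0)
  where
  j≥0 = lit 2 ⊕ J≥0
  identity : ∀ S u J →
    let j = + 2 + J
        m = u - 1ℤ
        s = - S
        N = m + + 2 * j
        U = (s + j * (j - 1ℤ)) * (s + j * (j - 1ℤ) - m) - + 2 * (s + j * (j - 1ℤ)) * (j * j)
                + j * j * ((j - 1ℤ) * (j - 1ℤ))
        D = s + j * N
        x = s + (j - 1ℤ) * N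
        M = + 2 * (s * s) + + 3 * (j * j) * N in
    x * M - - (+ 2 * D * U)
    ≡ x * (+ 4 * (S * S) + j * j * (+ 3 + + 2 * J + u))
      + + 2 * (+ 3 + + 2 * J + u) * (+ 2 + + 2 * J + u) * j * S
  identity = solve-∀

-- Only the term of the certificate in N² can change sign; it does so at 2 s = j (j-1), where this
-- case ends.
second-lower-near : ∀ s m J → 0ℤ ≤ s → 0ℤ ≤ J → 0ℤ ≤ m + + 2 * (+ 2 + J) → 0ℤ ≤ (+ 2 + J) * (1ℤ + J)
        - + 2 * s →
  let j = + 2 + J
      N = m + + 2 * j in
  - (+ 2 * (s + j * N) * second s m j) ≤ (s + (j - 1ℤ) * N) * quad s N j
second-lower-near s m J s≥0 J≥0 N≥0 τ≥0 = by-nonneg (identity s m J) (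
  lit 4 ⊗ (s≥0 ⊗ s≥0 ⊗ s≥0) ⊕ lit 4 ⊗ (lit 1 ⊕ J≥0) ⊗ N≥0 ⊗ (s≥0 ⊗ s≥0) ⊕ j≥0 ⊗ j≥0 ⊗ N≥0 ⊗ s≥0
  ⊕ lit 2 ⊗ j≥0 ⊗ N≥0 ⊗ s≥0 ⊕ j≥0 ⊗ (N≥0 ⊗ N≥0) ⊗ τ≥0)
  where
  j≥0 = lit 2 ⊕ J≥0
  identity : ∀ s m J →
    let j = + 2 + J
        N = m + + 2 * j
        U = (s + j * (j - 1ℤ)) * (s + j * (j - 1ℤ) - m) - + 2 * (s + j * (j - 1ℤ)) * (j * j)
                + j * j * ((j - 1ℤ) * (j - 1ℤ))
        D = s + j * N
        x = s + (j - 1ℤ) * N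
        M = + 2 * (s * s) + + 3 * (j * j) * N in
    x * M - - (+ 2 * D * U)
    ≡ + 4 * (s * s * s) + + 4 * (+ 1 + J) * N * (s * s) + j * j * N * s + + 2 * j * N * s
      + j * (N * N) * (j * (+ 1 + J) - + 2 * s)
  identity = solve-∀

-- Beyond 2 s = j (j-1) the N² term is absorbed through m ≤ (d - j)(e - j), which limits N in terms
-- of s. The factor 8 keeps the completed square integral.
second-lower-far : ∀ s m J → 0ℤ ≤ s → 0ℤ ≤ J → 0ℤ ≤ m + + 2 * (+ 3 + J) → 0ℤ ≤ s + (+ 3 + J) * (+ 2 + J)
        - m → 0ℤ ≤ + 2 * s - (+ 3 + J) * (+ 2 + J) →
  let j = + 3 + J
      N = m + + 2 * j in
  + 8 * - (+ 2 * (s + j * N) * second s m j) ≤ + 8 * ((s + (j - 1ℤ) * N) * quad s N j)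
second-lower-far s m J s≥0 J≥0 N≥0 ρ≥0 τ≥0 = by-nonneg (identity s m J) (
  lit 32 ⊗ (s≥0 ⊗ s≥0 ⊗ s≥0)
  ⊕ N≥0 ⊗ ((lit 1 ⊕ J≥0) ⊗ square (+ 4 * s - (J * J + + 10 * J + + 40))
          ⊕ ((lit 104 ⊗ J≥0 ⊕ lit 8) ⊗ s≥0 ⊕ lit 7 ⊗ J≥0 ⊗ J≥0 ⊗ J≥0 ⊗ J≥0 ⊗ J≥0
                  ⊕ lit 99 ⊗ J≥0 ⊗ J≥0 ⊗ J≥0 ⊗ J≥0 ⊕ lit 512 ⊗ J≥0 ⊗ J≥0 ⊗ J≥0 ⊕ lit 1108 ⊗ J≥0 ⊗ J≥0
                          ⊕ lit 624 ⊗ J≥0 ⊕ lit 128) ⊕ lit 8 ⊗ j≥0 ⊗ ρ≥0 ⊗ τ≥0))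
  where
  j≥0 = lit 3 ⊕ J≥0
  identity : ∀ s m J →
    let j = + 3 + J
        N = m + + 2 * j
        U = (s + j * (j - 1ℤ)) * (s + j * (j - 1ℤ) - m) - + 2 * (s + j * (j - 1ℤ)) * (j * j)
                + j * j * ((j - 1ℤ) * (j - 1ℤ))
        D = s + j * N
        x = s + (j - 1ℤ) * N
        M = + 2 * (s * s) + + 3 * (j * j) * N in
    + 8 * (x * M) - + 8 * - (+ 2 * D * U)
    ≡ + 32 * (s * s * s)
      + N * ((+ 1 + J) * ((+ 4 * s - (J * J + + 10 * J + + 40)) * (+ 4 * s - (J * J + + 10 * J + + 40)))
              + ((+ 104 * J + + 8) * s + + 7 * J * J * J * J * J + + 99 * J * J * J * J
                      + + 512 * J * J * J + + 1108 * J * J + + 624 * J + + 128)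
                              + + 8 * j * (s + j * (+ 2 + J) - m) * (+ 2 * s - j * (+ 2 + J)))
  identity = solve-∀

-- The cubic left over for j = 2 is negative between 3 and the square root of 12, but not at any
-- integer s ≥ 2; so its sign enters as a hypothesis.
second-lower-far-two : ∀ s m → 0ℤ ≤ m + + 4 → 0ℤ ≤ s + + 2 - m → 0ℤ ≤ s - + 1 → 0ℤ ≤ s - + 2 → 0ℤ
        ≤ (s - + 3) * (s * s - + 12) →
  let j = + 2
      N = m + + 2 * j in
  - (+ 2 * (s + j * N) * second s m j) ≤ (s + (j - 1ℤ) * N) * quad s N j
second-lower-far-two s m N≥0 ρ≥0 s≥1 s≥2 f≥0 = by-nonneg (identity s m) (
  lit 4 ⊗ (f≥0 ⊕ lit 3 ⊗ ρ≥0 ⊗ s≥2 ⊕ N≥0 ⊗ ρ≥0 ⊗ s≥1))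
  where
  identity : ∀ s m →
    let j = + 2
        N = m + + 2 * j
        U = (s + j * (j - 1ℤ)) * (s + j * (j - 1ℤ) - m) - + 2 * (s + j * (j - 1ℤ)) * (j * j)
                + j * j * ((j - 1ℤ) * (j - 1ℤ))
        D = s + j * N
        x = s + (j - 1ℤ) * N
        M = + 2 * (s * s) + + 3 * (j * j) * N in
    x * M - - (+ 2 * D * U)
    ≡ + 4 * ((s - + 3) * (s * s - + 12) + + 3 * (s + + 2 - m) * (s - + 2)
            + N * (s + + 2 - m) * (s - + 1))
  identity = solve-∀

-- In the strip, the window bounds of the children add up to at most - E_j(1)

critical-pos : ∀ S u J → 0ℤ ≤ S → 0ℤ ≤ u → 0ℤ ≤ J → 0ℤ ≤ + 2 * J + + 2 - S →
  let j = + 3 + J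
      m = + 2 + + 2 * J + u
      s = - (1ℤ + S)
      N = m + + 2 * j in
  children s m j ≤ + 2 * ((s + (j - 1ℤ) * N) * (s + (j - 1ℤ) * N)) * (j - s)
critical-pos S u J S≥0 u≥0 J≥0 τ≥0 = by-nonneg (identity S u J) (
  S≥0 ⊗ (lit 20 ⊗ (J≥0 ⊗ J≥0) ⊕ lit 76 ⊗ J≥0 ⊕ lit 68 ⊕ lit 4 ⊗ u≥0 ⊗ (J≥0 ⊕ lit 1)) ⊗ τ≥0
  ⊕ lit 4 ⊗ S≥0 ⊗ S≥0 ⊗ S≥0 ⊕ (lit 2 ⊗ J≥0 ⊗ J≥0 ⊕ lit 8 ⊗ J≥0 ⊕ lit 10) ⊗ S≥0 ⊗ u≥0 ⊗ u≥0
  ⊕ (lit 16 ⊗ J≥0 ⊗ J≥0 ⊗ J≥0 ⊕ lit 83 ⊗ J≥0 ⊗ J≥0 ⊕ lit 154 ⊗ J≥0 ⊕ lit 99) ⊗ S≥0 ⊗ u≥0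
  ⊕ (lit 32 ⊗ J≥0 ⊗ J≥0 ⊗ J≥0 ⊗ J≥0 ⊕ lit 212 ⊗ J≥0 ⊗ J≥0 ⊗ J≥0 ⊕ lit 538 ⊗ J≥0 ⊗ J≥0 ⊕ lit 640 ⊗ J≥0
          ⊕ lit 302) ⊗ S≥0
  ⊕ (lit 2 ⊗ J≥0 ⊗ J≥0 ⊗ J≥0 ⊕ lit 14 ⊗ J≥0 ⊗ J≥0 ⊕ lit 30 ⊗ J≥0 ⊕ lit 22) ⊗ u≥0 ⊗ u≥0
  ⊕ (lit 10 ⊗ J≥0 ⊗ J≥0 ⊗ J≥0 ⊗ J≥0 ⊕ lit 89 ⊗ J≥0 ⊗ J≥0 ⊗ J≥0 ⊕ lit 277 ⊗ J≥0 ⊗ J≥0 ⊕ lit 367 ⊗ J≥0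
          ⊕ lit 177) ⊗ u≥0
  ⊕ lit 8 ⊗ J≥0 ⊗ J≥0 ⊗ J≥0 ⊗ J≥0 ⊗ J≥0 ⊕ lit 80 ⊗ J≥0 ⊗ J≥0 ⊗ J≥0 ⊗ J≥0
  ⊕ lit 290 ⊗ J≥0 ⊗ J≥0 ⊗ J≥0 ⊕ lit 478 ⊗ J≥0 ⊗ J≥0 ⊕ lit 354 ⊗ J≥0 ⊕ lit 90)
  where
  identity : ∀ S u J →
    let j = + 3 + J
        m = + 2 + + 2 * J + u
        s = - (1ℤ + S)
        N = m + + 2 * j
        M = + 2 * (s * s) + + 3 * (j * j) * N
        M′ = + 2 * ((s - m) * (s - m)) + + 3 * (j * j) * (N - + 2)
        M″ = + 2 * ((s + + 2 * (j - 1ℤ)) * (s + + 2 * (j - 1ℤ)))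
                + + 3 * ((j - 1ℤ) * (j - 1ℤ)) * (N - + 2)
        L = (s + j * (j - 1ℤ)) * M′ + j * j * M″
        x = s + (j - 1ℤ) * N in
    + 2 * (x * x) * (j - s) - L
    ≡ S * (+ 20 * (J * J) + + 76 * J + + 68 + + 4 * u * (J + + 1)) * (+ 2 * J + + 2 - S)
      + + 4 * S * S * S + (+ 2 * J * J + + 8 * J + + 10) * S * u * u
      + (+ 16 * J * J * J + + 83 * J * J + + 154 * J + + 99) * S * u
      + (+ 32 * J * J * J * J + + 212 * J * J * J + + 538 * J * J + + 640 * J + + 302) * S
      + (+ 2 * J * J * J + + 14 * J * J + + 30 * J + + 22) * u * u
      + (+ 10 * J * J * J * J + + 89 * J * J * J + + 277 * J * J + + 367 * J + + 177) * u
      + + 8 * J * J * J * J * J + + 80 * J * J * J * J + + 290 * J * J * J + + 478 * J * J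
      + + 354 * J + + 90
  identity = solve-∀

-- At s = 0 the means give the better bound m ≥ 2 j - 2. The estimate is sharp: equality holds for j
-- = 4, m = 6.
critical-zero : ∀ u J → 0ℤ ≤ u → 0ℤ ≤ J →
  let j = + 4 + J
      m = + 6 + + 2 * J + u
      s = 0ℤ
      N = m + + 2 * j in
  children s m j ≤ + 2 * ((s + (j - 1ℤ) * N) * (s + (j - 1ℤ) * N)) * (j - s)
critical-zero u J u≥0 J≥0 = by-nonneg (identity u J) (
  (lit 2 ⊗ J≥0 ⊗ J≥0 ⊗ J≥0 ⊕ lit 18 ⊗ J≥0 ⊗ J≥0 ⊕ lit 52 ⊗ J≥0 ⊕ lit 48) ⊗ u≥0 ⊗ u≥0
  ⊕ (lit 10 ⊗ J≥0 ⊗ J≥0 ⊗ J≥0 ⊗ J≥0 ⊕ lit 121 ⊗ J≥0 ⊗ J≥0 ⊗ J≥0 ⊕ lit 537 ⊗ J≥0 ⊗ J≥0 ⊕ lit 1032 ⊗ J≥0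
          ⊕ lit 720) ⊗ u≥0
  ⊕ lit 8 ⊗ J≥0 ⊗ J≥0 ⊗ J≥0 ⊗ J≥0 ⊗ J≥0 ⊕ lit 108 ⊗ J≥0 ⊗ J≥0 ⊗ J≥0 ⊗ J≥0
  ⊕ lit 544 ⊗ J≥0 ⊗ J≥0 ⊗ J≥0 ⊕ lit 1212 ⊗ J≥0 ⊗ J≥0 ⊕ lit 1008 ⊗ J≥0)
  where
  identity : ∀ u J →
    let j = + 4 + J
        m = + 6 + + 2 * J + u
        s = 0ℤ
        N = m + + 2 * j
        M = + 2 * (s * s) + + 3 * (j * j) * N
        M′ = + 2 * ((s - m) * (s - m)) + + 3 * (j * j) * (N - + 2)
        M″ = + 2 * ((s + + 2 * (j - 1ℤ)) * (s + + 2 * (j - 1ℤ)))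
                + + 3 * ((j - 1ℤ) * (j - 1ℤ)) * (N - + 2)
        L = (s + j * (j - 1ℤ)) * M′ + j * j * M″
        x = s + (j - 1ℤ) * N in
    + 2 * (x * x) * (j - s) - L
    ≡ (+ 2 * J * J * J + + 18 * J * J + + 52 * J + + 48) * u * u
      + (+ 10 * J * J * J * J + + 121 * J * J * J + + 537 * J * J + + 1032 * J + + 720) * u
      + + 8 * J * J * J * J * J + + 108 * J * J * J * J + + 544 * J * J * J + + 1212 * J * J
      + + 1008 * J
  identity = solve-∀

-- Bounds inherited from both children, and E_j(2) in the strip

adds-inner : ∀ S u J → 0ℤ ≤ S → 0ℤ ≤ u → 0ℤ ≤ J →
  let j = 1ℤ + J
      m = 1ℤ + u
      s = - S
      N = m + + 2 * j in
  (s + j * (j - 1ℤ)) * (S + m + j) + j * j * (S - j + 1ℤ) ≤ (s + (j - 1ℤ) * N) * (S + j)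
adds-inner S u J S≥0 u≥0 J≥0 = by-nonneg (identity S u J) (
  j≥0 ⊗ S≥0 ⊗ u≥0 ⊕ lit 2 ⊗ (j≥0 ⊗ j≥0) ⊗ J≥0)
  where
  j≥0 = lit 1 ⊕ J≥0
  identity : ∀ S u J →
    let j = 1ℤ + J
        m = 1ℤ + u
        s = - S
        N = m + + 2 * j in
    (s + (j - 1ℤ) * N) * (S + j) - ((s + j * (j - 1ℤ)) * (S + m + j) + j * j * (S - j + 1ℤ))
    ≡ j * S * u + + 2 * (j * j) * J
  identity = solve-∀

-- The boundary d = j, with u = e - j; here m = u - 1 may be negative.
adds-edge : ∀ u J → 0ℤ ≤ u → 0ℤ ≤ J →
  let j = 1ℤ + J
      m = u - 1ℤ
      S = j * J
      s = - S
      N = m + + 2 * j in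
  (s + j * (j - 1ℤ)) * (S + m + j) + j * j * (S - j + 1ℤ) ≤ (s + (j - 1ℤ) * N) * (S + j)
adds-edge u J u≥0 J≥0 = by-nonneg (identity u J) (
  j≥0 ⊗ j≥0 ⊗ J≥0 ⊗ u≥0)
  where
  j≥0 = lit 1 ⊕ J≥0
  identity : ∀ u J →
    let j = 1ℤ + J
        m = u - 1ℤ
        S = j * J
        s = - S
        N = m + + 2 * j in
    (s + (j - 1ℤ) * N) * (S + j) - ((s + j * (j - 1ℤ)) * (S + m + j) + j * j * (S - j + 1ℤ))
    ≡ j * j * J * u
  identity = solve-∀

-- As d e E_j(1) = (s - j) w, the difference of the two sides is d e (d-1)(e-1) (E_j(2) - E_j(1)) /
-- w, which equals j S (n - 2).
second-critical-lower : ∀ S u J → 0ℤ ≤ S → 0ℤ ≤ u → 0ℤ ≤ J →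
  let j = + 2 + J
      m = u - 1ℤ
      s = - S
      N = m + + 2 * j in
  - ((s + (j - 1ℤ) * N) * (j - s)) ≤ second s m j
second-critical-lower S u J S≥0 u≥0 J≥0 = by-nonneg (identity S u J) (
  j≥0 ⊗ S≥0 ⊗ (lit 2 ⊕ lit 2 ⊗ J≥0 ⊕ u≥0))
  where
  j≥0 = lit 2 ⊕ J≥0
  identity : ∀ S u J →
    let j = + 2 + J
        m = u - 1ℤ
        s = - S
        N = m + + 2 * j
        U = (s + j * (j - 1ℤ)) * (s + j * (j - 1ℤ) - m) - + 2 * (s + j * (j - 1ℤ)) * (j * j)
                + j * j * ((j - 1ℤ) * (j - 1ℤ))
        x = s + (j - 1ℤ) * N in
    U - - (x * (j - s))
    ≡ j * S * (+ 2 + + 2 * J + u)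
  identity = solve-∀

second-critical-upper : ∀ S u J → 0ℤ ≤ S → 0ℤ ≤ u → 0ℤ ≤ J → 0ℤ ≤ + 2 * J + + 2 - S →
  let j = + 2 + J
      m = u - 1ℤ
      s = - S
      N = m + + 2 * j in
  second s m j ≤ (s + (j - 1ℤ) * N) * (j - s)
second-critical-upper S u J S≥0 u≥0 J≥0 τ≥0 = by-nonneg (identity S u J) (
  S≥0 ⊗ (J≥0 ⊗ (lit 4 ⊗ J≥0 ⊕ lit 5) ⊕ (lit 2 ⊗ J≥0 ⊕ lit 2) ⊗ u≥0)
  ⊕ j≥0 ⊗ (lit 3 ⊕ lit 2 ⊗ J≥0 ⊕ u≥0) ⊗ τ≥0 ⊕ lit 2 ⊗ S≥0 ⊗ τ≥0)
  where
  j≥0 = lit 2 ⊕ J≥0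
  identity : ∀ S u J →
    let j = + 2 + J
        m = u - 1ℤ
        s = - S
        N = m + + 2 * j
        U = (s + j * (j - 1ℤ)) * (s + j * (j - 1ℤ) - m) - + 2 * (s + j * (j - 1ℤ)) * (j * j)
                + j * j * ((j - 1ℤ) * (j - 1ℤ))
        x = s + (j - 1ℤ) * N in
    x * (j - s) - U
    ≡ S * (J * (+ 4 * J + + 5) + (+ 2 * J + + 2) * u)
      + j * (+ 3 + + 2 * J + u) * (+ 2 * J + + 2 - S) + + 2 * S * (+ 2 * J + + 2 - S)
  identity = solve-∀

-- The case j = 1, where E_1(i) = (d - i)(e - i) - i

one-upper : ∀ k c f → 0ℤ ≤ k → 0ℤ ≤ c → 0ℤ ≤ f →
  let d = + 2 + k + c
      e = + 2 + k + f in
  + 2 * (d * e) * (c * f - (+ 2 + k)) ≤ + 2 * ((d - 1ℤ) * (e - 1ℤ) * ((d - 1ℤ) * (e - 1ℤ)))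
          + + 3 * (d + e - 1ℤ)
one-upper k c f k≥0 c≥0 f≥0 = by-nonneg (identity k c f) (
  lit 2 ⊗ ((lit 2 ⊕ k≥0 ⊕ c≥0) ⊗ (lit 2 ⊕ k≥0 ⊕ f≥0)) ⊗ (lit 2 ⊕ k≥0)
  ⊕ lit 3 ⊗ (lit 3 ⊕ lit 2 ⊗ k≥0 ⊕ c≥0 ⊕ f≥0)
  ⊕ lit 2 ⊗ ((lit 1 ⊕ k≥0) ⊗ (lit 1 ⊕ k≥0) ⊕ k≥0 ⊗ c≥0) ⊗ ((lit 1 ⊕ k≥0 ⊕ f≥0) ⊗ (lit 1 ⊕ k≥0 ⊕ f≥0))
  ⊕ lit 2 ⊗ c≥0 ⊗ (lit 2 ⊕ k≥0 ⊕ c≥0) ⊗ ((lit 1 ⊕ k≥0) ⊗ (lit 1 ⊕ k≥0) ⊕ k≥0 ⊗ f≥0))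
  where
  identity : ∀ k c f →
    let d = + 2 + k + c
        e = + 2 + k + f in
    + 2 * ((d - 1ℤ) * (e - 1ℤ) * ((d - 1ℤ) * (e - 1ℤ))) + + 3 * (d + e - 1ℤ)
            - + 2 * (d * e) * (c * f - (+ 2 + k))
    ≡ + 2 * ((+ 2 + k + c) * (+ 2 + k + f)) * (+ 2 + k) + + 3 * (+ 3 + + 2 * k + c + f)
      + + 2 * ((+ 1 + k) * (+ 1 + k) + k * c) * ((+ 1 + k + f) * (+ 1 + k + f))
      + + 2 * c * (+ 2 + k + c) * ((+ 1 + k) * (+ 1 + k) + k * f)
  identity = solve-∀

-- Since - E_1(i) ≤ i ≤ d, it is enough to bound d in place of - E_1(i). The inequality fails for
-- (d,e) = (2,2), (2,3) and (3,3), hence the start at e = 4.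
one-lower : ∀ A B → 0ℤ ≤ A → 0ℤ ≤ B →
  let d = + 2 + A
      e = + 4 + B in
  + 2 * (d * e) * d ≤ + 2 * ((d - 1ℤ) * (e - 1ℤ) * ((d - 1ℤ) * (e - 1ℤ))) + + 3 * (d + e - 1ℤ)
one-lower A B A≥0 B≥0 = by-nonneg (identity A B) (
  (lit 2 ⊗ B≥0 ⊗ B≥0 ⊕ lit 10 ⊗ B≥0 ⊕ lit 10) ⊗ A≥0 ⊗ A≥0
  ⊕ (lit 4 ⊗ B≥0 ⊗ B≥0 ⊕ lit 16 ⊗ B≥0 ⊕ lit 7) ⊗ A≥0 ⊕ lit 2 ⊗ B≥0 ⊗ B≥0 ⊕ lit 7 ⊗ B≥0 ⊕ lit 1)
  where
  identity : ∀ A B →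
    let d = + 2 + A
        e = + 4 + B in
    + 2 * ((d - 1ℤ) * (e - 1ℤ) * ((d - 1ℤ) * (e - 1ℤ))) + + 3 * (d + e - 1ℤ) - + 2 * (d * e) * d
    ≡ (+ 2 * B * B + + 10 * B + + 10) * A * A + (+ 4 * B * B + + 16 * B + + 7) * A + + 2 * B * B
      + + 7 * B + + 1
  identity = solve-∀

-- Contraction for all admissible parameters

quad≥0 : ∀ s {N} j → 0ℤ ≤ N → 0ℤ ≤ quad s N j
quad≥0 s j N≥0 = lit 2 ⊗ square s ⊕ lit 3 ⊗ square j ⊗ N≥0

-- Writing D = s + j N, x = D - N and Y for the coefficient of quad below, j² x² = D Y + s².
contracts-by-Y : ∀ s m k → let j = + suc k ; N = m + + 2 * j in
  0ℤ ≤ N → 0ℤ ≤ s + j * N →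
  j * j * children s m j ≤ (j - 1ℤ) * (s * (j + 1ℤ) + j * N * (j - 1ℤ)) * quad s N j →
  Contracts s m j
contracts-by-Y s m k N≥0 D≥0 L≤Y =
  ℤ.*-cancelˡ-≤-pos _ _ (j * j) (by-nonneg
    (identity s j N (quad s N j) (children s m j))
    (D≥0 ⊗ ℤ.i≤j⇒0≤j-i L≤Y ⊕ square s ⊗ quad≥0 s j N≥0))
  where
  j = + suc k
  N = m + + 2 * j
  identity : ∀ s j N M L →
    let D = s + j * N
        x = s + (j - 1ℤ) * N
        Y = (j - 1ℤ) * (s * (j + 1ℤ) + j * N * (j - 1ℤ)) in
    j * j * (x * x * M) - j * j * (D * L) ≡ D * (Y * M - j * j * L) + s * s * M
  identity = solve-∀

-- With x = D - N one has x² = D (D - 2 N) + N², and the nonnegative term N² `quad` is given away.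
contracts-by-D-2N : ∀ s m j → let N = m + + 2 * j in
  0ℤ ≤ N → 0ℤ ≤ s + j * N →
  children s m j ≤ (s + j * N - + 2 * N) * quad s N j →
  Contracts s m j
contracts-by-D-2N s m j N≥0 D≥0 L≤ =
  by-nonneg (identity s j N (quad s N j) (children s m j))
            (D≥0 ⊗ ℤ.i≤j⇒0≤j-i L≤ ⊕ square N ⊗ quad≥0 s j N≥0)
  where
  N = m + + 2 * j
  identity : ∀ s j N M L →
    let D = s + j * N
        x = s + (j - 1ℤ) * N in
    x * x * M - D * L ≡ D * ((D - + 2 * N) * M - L) + N * N * M
  identity = solve-∀

square-reflects-< : ∀ {x y} → 0ℤ ≤ y → 1ℤ ≤ x → x * x < y * y → x < y
square-reflects-< {x} {y} y≥0 x≥1 x²<y² = ℤ.≰⇒> λ y≤x → ℤ.<⇒≱ x²<y²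
  (by-nonneg (identity x y) (ℤ.i≤j⇒0≤j-i y≤x ⊗ (ℤ.≤-trans (lit 0) x≥0 ⊕ y≥0)))
  where
  x≥0 = ℤ.≤-trans (lit 1) x≥1
  identity : ∀ x y → x * x - y * y ≡ (x - y) * (x + y)
  identity = solve-∀

-- Over the integers, q < m + 1 obtained from the squares sharpens to q ≤ m.
1+square-reflects-≤ : ∀ {q m} → 1ℤ ≤ q → 0ℤ ≤ m → 1ℤ + q * q ≤ (m + 1ℤ) * (m + 1ℤ) → q ≤ m
1+square-reflects-≤ {q} {m} q≥1 m≥0 q²<[m+1]² =
  subst (q ≤_) (identity m) (ℤ.i<j⇒i≤pred[j]
    (square-reflects-< (m≥0 ⊕ lit 1) q≥1 (ℤ.suc[i]≤j⇒i<j q²<[m+1]²)))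
  where
  identity : ∀ m → -1ℤ + (m + 1ℤ) ≡ m
  identity = solve-∀

-- In the application m + 1 = a + b and s + j (j - 1) = a b, so the last hypothesis is the
-- inequality of the means.
means-bound : ∀ s m k → let j = + 2 + + k in
  0ℤ ≤ m → 1ℤ ≤ s → + 4 * (s + j * (j - 1ℤ)) ≤ (m + 1ℤ) * (m + 1ℤ) → + 3 + + 2 * + k ≤ m
means-bound s m k m≥0 s≥1 means = 1+square-reflects-≤ (ℤ.+-mono-≤ {1ℤ} {+ 3} (+≤+ (ℕ.s≤s ℕ.z≤n)) (lit 2
        ⊗ lit k)) m≥0
  (ℤ.≤-trans (by-nonneg (identity s (+ k)) (lit 4 ⊗ ℤ.i≤j⇒0≤j-i s≥1 ⊕ lit 2)) means)
  where
  identity : ∀ s k →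
    + 4 * (s + (+ 2 + k) * (+ 2 + k - 1ℤ)) - (1ℤ + (+ 3 + + 2 * k) * (+ 3 + + 2 * k)) ≡ + 4 * (s - 1ℤ)
            + + 2
  identity = solve-∀

D-nonneg : ∀ s m k → let j = + 2 + + k in
  0ℤ ≤ m → m ≤ s + j * (j - 1ℤ) → 0ℤ ≤ s + j * (m + + 2 * j)
D-nonneg s m k m≥0 m≤p = subst (0ℤ ≤_) (identity s m (+ 2 + + k))
  (ℤ.≤-trans m≥0 m≤p ⊕ lit (2 ℕ.+ k) ⊗ (m≥0 ⊕ lit (2 ℕ.+ k) ⊕ lit 1))
  where
  identity : ∀ s m j → s + j * (j - 1ℤ) + j * (m + j + 1ℤ) ≡ s + j * (m + + 2 * j)
  identity = solve-∀

shift : ∀ q m → m ≡ q + (m - q)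
shift = solve-∀

-- The hypotheses are what a, b ≥ 1 imply for m = a + b - 1 and `s + j * (j - 1ℤ)` = a b. The cases
-- are s ≤ 0, then s > 0 with j = 2, then s > 0 with j ≥ 3.
contracts : ∀ s m k → let j = + 2 + + k in
  1ℤ ≤ m → m ≤ s + j * (j - 1ℤ) → + 4 * (s + j * (j - 1ℤ)) ≤ (m + 1ℤ) * (m + 1ℤ) →
  Contracts s m j
contracts s m k m≥1 m≤p means = go s k m≤p means
  where
  m≥0 = ℤ.≤-trans (lit 1) m≥1
  N≥0 : ∀ k → 0ℤ ≤ m + + 2 * (+ 2 + + k)
  N≥0 k = m≥0 ⊕ lit 2 ⊗ lit (2 ℕ.+ k)

  below : ∀ n k → let j = + 2 + + k in m ≤ - + n + j * (j - 1ℤ) → Contracts (- + n) m j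
  below n k m≤p = contracts-by-Y (- + n) m (suc k) (N≥0 k) (D-nonneg (- + n) m k m≥0 m≤p)
    (subst (λ m → j * j * children (- + n) m j
                ≤ (j - 1ℤ) * (- + n * (j + 1ℤ) + j * (m + + 2 * j) * (j - 1ℤ)) * quad (- + n) (m
                        + + 2 * j) j)
      (sym (shift 1ℤ m))
      (contract-below (+ n) (m - 1ℤ) (+ k) (lit n) (ℤ.i≤j⇒0≤j-i m≥1) (lit k)
        (subst (0ℤ ≤_) (ℤ.+-comm (- + n) (j * (j - 1ℤ))) (ℤ.≤-trans m≥0 m≤p))))
    where j = + 2 + + k

  go : ∀ s k → let j = + 2 + + k in
    m ≤ s + j * (j - 1ℤ) → + 4 * (s + j * (j - 1ℤ)) ≤ (m + 1ℤ) * (m + 1ℤ) → Contracts s m j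
  go (+ zero)  k m≤p means = below zero k m≤p
  go -[1+ n ]  k m≤p means = below (suc n) k m≤p
  go s@(+ suc n) zero m≤p means =
    subst (λ m → Contracts s m (+ 2)) (sym (shift (+ 3) m))
      (contract-above-two s (m - + 3) (lit (suc n)) (ℤ.i≤j⇒0≤j-i m≥3)
        (subst (0ℤ ≤_) (identity s m) (ℤ.i≤j⇒0≤j-i m≤p)))
    where
    m≥3 = means-bound s m 0 m≥0 (+≤+ (ℕ.s≤s ℕ.z≤n)) means
    identity : ∀ s m → s + + 2 * (+ 2 - 1ℤ) - m ≡ s - 1ℤ - (m - + 3)
    identity = solve-∀
  go s@(+ suc n) (suc k) m≤p means =
    contracts-by-D-2N s m j (N≥0 (suc k)) (D-nonneg s m (suc k) m≥0 m≤p)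
      (subst (λ m → children s m j ≤ (s + j * (m + + 2 * j) - + 2 * (m + + 2 * j)) * quad s (m + + 2 * j) j)
        (sym (shift (+ 5 + + 2 * + k) m))
        (contract-above s (m - (+ 5 + + 2 * + k)) (+ k) (lit (suc n)) (ℤ.i≤j⇒0≤j-i m≥) (lit k)
          (subst (λ m → 0ℤ ≤ s + j * (j - 1ℤ) - m) (shift (+ 5 + + 2 * + k) m) (ℤ.i≤j⇒0≤j-i m≤p))))
    where
    j = + 3 + + k
    m≥ : + 5 + + 2 * + k ≤ m
    m≥ = subst (_≤ m) (identity (+ k)) (means-bound s m (suc k) m≥0 (+≤+ (ℕ.s≤s ℕ.z≤n)) means)
      where
      identity : ∀ k → + 3 + + 2 * (1ℤ + k) ≡ + 5 + + 2 * k
      identity = solve-∀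

contracts-edge : ∀ u k → let j = + 2 + + k in Contracts (- (j * (j - 1ℤ))) (+ u) j
contracts-edge u k = contracts-by-Y (- (j * (j - 1ℤ))) (+ u) (suc k)
  (lit u ⊕ lit 2 ⊗ lit (2 ℕ.+ k))
  (subst (0ℤ ≤_) (identity (+ u) j) (lit (2 ℕ.+ k) ⊗ (lit u ⊕ lit (2 ℕ.+ k) ⊕ lit 1)))
  (contract-edge (+ u) (+ k) (lit u) (lit k))
  where
  j = + 2 + + k
  identity : ∀ u j → j * (u + j + 1ℤ) ≡ - (j * (j - 1ℤ)) + j * (u + + 2 * j)
  identity = solve-∀

second-upper : ∀ s u k → let j = + 2 + + k ; m = u - 1ℤ ; N = m + + 2 * j in
  0ℤ ≤ u → 0ℤ ≤ s + j * (j - 1ℤ) →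
  + 2 * (s + j * N) * second s m j ≤ (s + (j - 1ℤ) * N) * quad s N j
second-upper (+ n)    u k u≥0 p≥0 = second-upper-above (+ n) u (+ k) (lit n) u≥0 (lit k)
second-upper -[1+ n ] u k u≥0 p≥0 = second-upper-below (+ suc n) u (+ k) (lit (suc n)) u≥0 (lit k)
  (subst (0ℤ ≤_) (ℤ.+-comm -[1+ n ] ((+ 2 + + k) * (1ℤ + + k))) p≥0)

second-lower : ∀ s u k → let j = + 2 + + k ; m = u - 1ℤ ; N = m + + 2 * j in
  0ℤ ≤ u → 0ℤ ≤ s + j * (j - 1ℤ) → (1ℤ ≤ s → m ≤ s + j * (j - 1ℤ)) →
  - (+ 2 * (s + j * N) * second s m j) ≤ (s + (j - 1ℤ) * N) * quad s N j
second-lower s u k u≥0 p≥0 m≤p = go s k p≥0 m≤p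
  where
  size≥0 : ∀ k → 0ℤ ≤ u - 1ℤ + + 2 * (+ 2 + + k)
  size≥0 k = subst (0ℤ ≤_) (identity u (+ k)) (u≥0 ⊕ lit 3 ⊕ lit 2 ⊗ lit k)
    where
    identity : ∀ u k → u + + 3 + + 2 * k ≡ u - 1ℤ + + 2 * (+ 2 + k)
    identity = solve-∀

  below : ∀ n k → let j = + 2 + + k ; m = u - 1ℤ ; N = m + + 2 * j in
    0ℤ ≤ - + n + j * (j - 1ℤ) →
    - (+ 2 * (- + n + j * N) * second (- + n) m j) ≤ (- + n + (j - 1ℤ) * N) * quad (- + n) N j
  below n k p≥0 = second-lower-below (+ n) u (+ k) (lit n) u≥0 (lit k)
    (subst (0ℤ ≤_) (identity (- + n) u (+ k)) (p≥0 ⊕ (lit 1 ⊕ lit k) ⊗ (lit 1 ⊕ lit k ⊕ u≥0)))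
    where
    identity : ∀ s u k →
      s + (+ 2 + k) * (+ 2 + k - 1ℤ) + (1ℤ + k) * (1ℤ + k + u) ≡ s
              + (+ 2 + k - 1ℤ) * (u - 1ℤ + + 2 * (+ 2 + k))
    identity = solve-∀

  go : ∀ s k → let j = + 2 + + k ; m = u - 1ℤ ; N = m + + 2 * j in
    0ℤ ≤ s + j * (j - 1ℤ) → (1ℤ ≤ s → m ≤ s + j * (j - 1ℤ)) →
    - (+ 2 * (s + j * N) * second s m j) ≤ (s + (j - 1ℤ) * N) * quad s N j
  go (+ zero)  k p≥0 _ = below zero k p≥0
  go -[1+ n ]  k p≥0 _ = below (suc n) k p≥0
  go s@(+ suc n) k _ m≤p with ℤ.≤-total (+ 2 * s) ((+ 2 + + k) * (1ℤ + + k))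
  ... | inj₁ 2s≤ = second-lower-near s (u - 1ℤ) (+ k) (lit (suc n)) (lit k) (size≥0 k) (ℤ.i≤j⇒0≤j-i 2s≤)
  go s@(+ suc n) (suc k) _ m≤p | inj₂ ≤2s = ℤ.*-cancelˡ-≤-pos _ _ (+ 8)
    (second-lower-far s (u - 1ℤ) (+ k) (lit (suc n)) (lit k) (size≥0 (suc k))
      (ℤ.i≤j⇒0≤j-i (m≤p (+≤+ (ℕ.s≤s ℕ.z≤n)))) (ℤ.i≤j⇒0≤j-i ≤2s))
  -- For j = 2 and s = 1 one has 2 s = j (j-1), so the near case still applies.
  go s@(+ 1) zero _ m≤p | inj₂ _ =
    second-lower-near s (u - 1ℤ) 0ℤ (lit 1) (lit 0) (size≥0 0) (lit 0)
  go s@(+ suc (suc n)) zero _ m≤p | inj₂ _ =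
    second-lower-far-two s (u - 1ℤ) (size≥0 0) (ℤ.i≤j⇒0≤j-i (m≤p (+≤+ (ℕ.s≤s ℕ.z≤n))))
      (lit (suc n)) (lit n) (cubic n)
    where
    cubic : ∀ n → 0ℤ ≤ (+ suc (suc n) - + 3) * (+ suc (suc n) * + suc (suc n) - + 12)
    cubic 0 = lit 8
    cubic 1 = lit 0
    cubic (suc (suc n)) = lit (suc n) ⊗
      subst (0ℤ ≤_) (identity (+ n)) (lit n ⊗ lit n ⊕ lit 8 ⊗ lit n ⊕ lit 4)
      where
      identity : ∀ n → n * n + + 8 * n + + 4 ≡ (+ 4 + n) * (+ 4 + n) - + 12
      identity = solve-∀

-- The eigenvalues for i = 1 and i = 2

w : (d e j : ℕ) → ℤ
w d e j = + (d C j) * + (e C j)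

w≥0 : ∀ d e j → 0ℤ ≤ w d e j
w≥0 d e j = lit (d C j) ⊗ lit (e C j)

-- Absorption in both binomials. Together with `w-outer` this yields the weights (d - j)(e - j) and
-- j² of the two children, after multiplication by d e.
w-inner : ∀ d e j → + suc d * + suc e * w d e (suc j)
        ≡ (+ suc d - + suc j) * (+ suc e - + suc j) * w (suc d) (suc e) (suc j)
w-inner d e j = begin
  + suc d * + suc e * w d e (suc j)
    ≡⟨ interchange (+ suc d) (+ suc e) (+ (d C suc j)) (+ (e C suc j)) ⟩
  + suc d * + (d C suc j) * (+ suc e * + (e C suc j))
    ≡⟨ cong₂ _*_ (co-absorbℤ d j) (co-absorbℤ e j) ⟩
  (+ suc d - + suc j) * x * ((+ suc e - + suc j) * y)
    ≡⟨ interchange (+ suc d - + suc j) (+ suc e - + suc j) x y ⟨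
  (+ suc d - + suc j) * (+ suc e - + suc j) * w (suc d) (suc e) (suc j) ∎
  where
  open ≡-Reasoning
  x = + (suc d C suc j)
  y = + (suc e C suc j)
  interchange : ∀ p q x y → p * q * (x * y) ≡ p * x * (q * y)
  interchange = solve-∀

w-outer : ∀ d e j → + suc d * + suc e * w d e j ≡ + suc j * + suc j * w (suc d) (suc e) (suc j)
w-outer d e j = begin
  + suc d * + suc e * w d e j
    ≡⟨ interchange (+ suc d) (+ suc e) (+ (d C j)) (+ (e C j)) ⟩
  + suc d * + (d C j) * (+ suc e * + (e C j))
    ≡⟨ cong₂ _*_ (absorbℤ d j) (absorbℤ e j) ⟩
  + suc j * x * (+ suc j * y)
    ≡⟨ interchange (+ suc j) (+ suc j) x y ⟨
  + suc j * + suc j * w (suc d) (suc e) (suc j) ∎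
  where
  open ≡-Reasoning
  x = + (suc d C suc j)
  y = + (suc e C suc j)
  interchange : ∀ p q x y → p * q * (x * y) ≡ p * x * (q * y)
  interchange = solve-∀

-- This is s, in its factored form.
excess : (d e j : ℕ) → ℤ
excess d e j = (+ d - + j) * (+ e - + j) - + j * (+ j - 1ℤ)

-- This is m, that is (d - j) + (e - j) - 1.
margin : (d e j : ℕ) → ℤ
margin d e j = + d + + e - 1ℤ - + 2 * + j

-- How s, m and N change under the recursion

module _ (d e j : ℕ) where

  private
    s = excess (suc d) (suc e) (suc j)
    m = margin (suc d) (suc e) (suc j)
    J = + suc j
    N = m + + 2 * J

  excess-inner : excess d e (suc j) ≡ s - m
  excess-inner = identity (+ d) (+ e) (+ j)
    where
    identity : ∀ d e j →
      let J = 1ℤ + j in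
      (d - J) * (e - J) - J * (J - 1ℤ)
      ≡ (1ℤ + d - J) * (1ℤ + e - J) - J * (J - 1ℤ) - (1ℤ + d + (1ℤ + e) - 1ℤ - + 2 * J)
    identity = solve-∀

  excess-outer : excess d e j ≡ s + + 2 * (J - 1ℤ)
  excess-outer = identity (+ d) (+ e) (+ j)
    where
    identity : ∀ d e j →
      let J = 1ℤ + j in
      (d - j) * (e - j) - j * (j - 1ℤ)
      ≡ (1ℤ + d - J) * (1ℤ + e - J) - J * (J - 1ℤ) + + 2 * (J - 1ℤ)
    identity = solve-∀

  size-child : + d + + e - 1ℤ ≡ N - + 2
  size-child = identity (+ d) (+ e) (+ j)
    where
    identity : ∀ d e j → let J = 1ℤ + j in
      d + e - 1ℤ ≡ 1ℤ + d + (1ℤ + e) - 1ℤ - + 2 * J + + 2 * J - + 2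
    identity = solve-∀

  size : + suc d + + suc e - 1ℤ ≡ N
  size = identity (+ d) (+ e) (+ j)
    where
    identity : ∀ d e j → let J = 1ℤ + j in
      1ℤ + d + (1ℤ + e) - 1ℤ ≡ 1ℤ + d + (1ℤ + e) - 1ℤ - + 2 * J + + 2 * J
    identity = solve-∀

  product : + suc d * + suc e ≡ s + J * N
  product = identity (+ d) (+ e) (+ j)
    where
    identity : ∀ d e j → let J = 1ℤ + j in
      (1ℤ + d) * (1ℤ + e)
      ≡ (1ℤ + d - J) * (1ℤ + e - J) - J * (J - 1ℤ) + J * (1ℤ + d + (1ℤ + e) - 1ℤ - + 2 * J + + 2 * J)
    identity = solve-∀

  product-child : + d * + e ≡ s + (J - 1ℤ) * N
  product-child = identity (+ d) (+ e) (+ j)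
    where
    identity : ∀ d e j → let J = 1ℤ + j in
      d * e
      ≡ (1ℤ + d - J) * (1ℤ + e - J) - J * (J - 1ℤ)
              + (J - 1ℤ) * (1ℤ + d + (1ℤ + e) - 1ℤ - + 2 * J + + 2 * J)
    identity = solve-∀

  codegrees : (+ suc d - J) * (+ suc e - J) ≡ s + J * (J - 1ℤ)
  codegrees = identity ((+ suc d - J) * (+ suc e - J)) (J * (J - 1ℤ))
    where
    identity : ∀ x y → x ≡ x - y + y
    identity = solve-∀

  w-inner′ : + suc d * + suc e * w d e (suc j) ≡ (s + J * (J - 1ℤ)) * w (suc d) (suc e) (suc j)
  w-inner′ = trans (w-inner d e j) (cong (_* w (suc d) (suc e) (suc j)) codegrees)

-- A single recursion step: the weights (d - j)(e - j) and j² differ by s - j.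
D*T-one : ∀ c f j → + suc c * + suc f * T c f 1 (suc j)
        ≡ (excess (suc c) (suc f) (suc j) - + suc j) * w (suc c) (suc f) (suc j)
D*T-one c f j = begin
  D * (w c f (suc j) - w c f j)
    ≡⟨ distrib D (w c f (suc j)) (w c f j) ⟩
  D * w c f (suc j) - D * w c f j
    ≡⟨ cong₂ _-_ (w-inner′ c f j) (w-outer c f j) ⟩
  (s + J * (J - 1ℤ)) * W - J * J * W
    ≡⟨ identity s J W ⟩
  (s - J) * W ∎
  where
  open ≡-Reasoning
  D = + suc c * + suc f
  W = w (suc c) (suc f) (suc j)
  s = excess (suc c) (suc f) (suc j)
  J = + suc j
  distrib : ∀ x y z → x * (y - z) ≡ x * y - x * z
  distrib = solve-∀
  identity : ∀ s J W → (s + J * (J - 1ℤ)) * W - J * J * W ≡ (s - J) * W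
  identity = solve-∀

D*x*T-two : ∀ c f j → let d = suc (suc c) ; e = suc (suc f) ; J = suc (suc j) in
  + d * + e * (+ suc c * + suc f) * T c f 2 J ≡ second (excess d e J) (margin d e J) (+ J) * w d e J
D*x*T-two c f j = begin
  D * x * (T c f 1 (suc (suc j)) - T c f 1 (suc j))
    ≡⟨ distrib D x (T c f 1 (suc (suc j))) (T c f 1 (suc j)) ⟩
  D * (x * T c f 1 (suc (suc j))) - D * (x * T c f 1 (suc j))
    ≡⟨ cong₂ (λ y z → D * y - D * z) (D*T-one c f (suc j)) (D*T-one c f j) ⟩
  D * ((excess d′ e′ (suc (suc j)) - J) * w₁) - D * ((excess d′ e′ (suc j) - + suc j) * w₂)
    ≡⟨ cong₂ (λ y z → D * ((y - J) * w₁) - D * ((z - + suc j) * w₂)) (excess-inner d′ e′ (suc j))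
        (excess-outer d′ e′ (suc j)) ⟩
  D * ((s - m - J) * w₁) - D * ((s + + 2 * (J - 1ℤ) - + suc j) * w₂)
    ≡⟨ pull D (s - m - J) w₁ (s + + 2 * (J - 1ℤ) - + suc j) w₂ ⟩
  (s - m - J) * (D * w₁) - (s + + 2 * (J - 1ℤ) - + suc j) * (D * w₂)
    ≡⟨ cong₂ (λ y z → (s - m - J) * y - (s + + 2 * (J - 1ℤ) - + suc j) * z) (w-inner′ d′ e′ (suc j))
        (w-outer d′ e′ (suc j)) ⟩
  (s - m - J) * ((s + J * (J - 1ℤ)) * W) - (s + + 2 * (J - 1ℤ) - + suc j) * (J * J * W)
    ≡⟨ identity s m (+ j) W ⟩
  second s m J * W ∎
  where
  open ≡-Reasoning
  d′ = suc c
  e′ = suc f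
  D = + suc d′ * + suc e′
  x = + suc c * + suc f
  J = + suc (suc j)
  s = excess (suc d′) (suc e′) (suc (suc j))
  m = margin (suc d′) (suc e′) (suc (suc j))
  W = w (suc d′) (suc e′) (suc (suc j))
  w₁ = w d′ e′ (suc (suc j))
  w₂ = w d′ e′ (suc j)
  distrib : ∀ D x y z → D * x * (y - z) ≡ D * (x * y) - D * (x * z)
  distrib = solve-∀
  pull : ∀ D a w b v → D * (a * w) - D * (b * v) ≡ a * (D * w) - b * (D * v)
  pull = solve-∀
  identity : ∀ s m j W → let J = + 2 + j in
    (s - m - J) * ((s + J * (J - 1ℤ)) * W) - (s + + 2 * (J - 1ℤ) - (1ℤ + j)) * (J * J * W)
    ≡ ((s + J * (J - 1ℤ)) * (s + J * (J - 1ℤ) - m) - + 2 * (s + J * (J - 1ℤ)) * (J * J)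
       + J * J * ((J - 1ℤ) * (J - 1ℤ))) * W
  identity = solve-∀

-- The two induction statements

-- Parametrised by c = d - i and f = e - i, which the recursion keeps fixed: lowering i alone passes
-- to d - 1 and e - 1.
Window : (c f i j : ℕ) → Set
Window c f i j = + ∣ T c f i j ∣ * (+ 2 * (D * D))
        ≤ w d e j * quad (excess d e j) (+ d + + e - 1ℤ) (+ j)
  where d = i ℕ.+ c ; e = i ℕ.+ f ; D = + d * + e

-- By `D*T-one` the right side is - d e E_j(1), so this is |E_j(i)| ≤ - E_j(1) multiplied by d e.
Dominated : (c f i j : ℕ) → Set
Dominated c f i j = + ∣ T c f i j ∣ * (+ d * + e) ≤ w d e j * (+ j - excess d e j)
  where d = i ℕ.+ c ; e = i ℕ.+ f

abs-bound : ∀ z X {B} → z * X ≤ B → - (z * X) ≤ B → + ∣ z ∣ * X ≤ B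
abs-bound z X {B} zX≤B -zX≤B with ℤ.+∣i∣≡i⊎+∣i∣≡-i z
... | inj₁ eq = subst (λ y → y * X ≤ B) (sym eq) zX≤B
... | inj₂ eq = subst (λ y → y * X ≤ B) (sym eq) (subst (_≤ B) (ℤ.neg-distribˡ-* z X) -zX≤B)

-- For j > d both sides vanish: the eigenvalue by degree, the valency by its binomial in d.
outside : ∀ c f i {j} X B → j ℕ.> i ℕ.+ c → + ∣ T c f i j ∣ * X ≤ w (i ℕ.+ c) (i ℕ.+ f) j * B
outside c f i X B j> rewrite k>c+i⇒T≡0 c f i j> | k>n⇒nCk≡0 j> = ℤ.≤-refl

-- The triangle inequality with weights: multiplication by D turns the valencies of the children
-- into the multiples p and q of W.
combine : ∀ A A′ A″ X D W W′ W″ p q M′ M″ → A ≤ A′ + A″ → 0ℤ ≤ X → 0ℤ ≤ D →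
  A′ * X ≤ W′ * M′ → A″ * X ≤ W″ * M″ → D * W′ ≡ p * W → D * W″ ≡ q * W →
  A * X * D ≤ W * (p * M′ + q * M″)
combine A A′ A″ X D W W′ W″ p q M′ M″ A≤ X≥0 D≥0 A′≤ A″≤ eq′ eq″ =
  subst (A * X * D ≤_) (begin
    D * W′ * M′ + D * W″ * M″  ≡⟨ cong₂ (λ y z → y * M′ + z * M″) eq′ eq″ ⟩
    p * W * M′ + q * W * M″    ≡⟨ factor p W M′ q M″ ⟩
    W * (p * M′ + q * M″)      ∎)
  (by-nonneg (identity A A′ A″ X D W′ M′ W″ M″)
    (D≥0 ⊗ ℤ.i≤j⇒0≤j-i A′≤ ⊕ D≥0 ⊗ ℤ.i≤j⇒0≤j-i A″≤ ⊕ ℤ.i≤j⇒0≤j-i A≤ ⊗ X≥0 ⊗ D≥0))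
  where
  open ≡-Reasoning
  factor : ∀ p W M′ q M″ → p * W * M′ + q * W * M″ ≡ W * (p * M′ + q * M″)
  factor = solve-∀
  identity : ∀ A A′ A″ X D W′ M′ W″ M″ → D * W′ * M′ + D * W″ * M″ - A * X * D
    ≡ D * (W′ * M′ - A′ * X) + D * (W″ * M″ - A″ * X) + (A′ + A″ - A) * X * D
  identity = solve-∀

*-mono-nonneg : ∀ {W a b} → 0ℤ ≤ W → a ≤ b → W * a ≤ W * b
*-mono-nonneg {W} {a} {b} W≥0 a≤b = by-nonneg (identity W a b) (W≥0 ⊗ ℤ.i≤j⇒0≤j-i a≤b)
  where
  identity : ∀ W a b → W * b - W * a ≡ W * (b - a)
  identity = solve-∀

module _ (c f i j : ℕ) where

  private
    d′ = suc i ℕ.+ c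
    e′ = suc i ℕ.+ f
    d = suc d′
    e = suc e′
    D = + d * + e
    x = + d′ * + e′
    J = + suc j
    s = excess d e (suc j)
    m = margin d e (suc j)
    N = m + + 2 * J
    W = w d e (suc j)
    A = + ∣ T c f (suc (suc i)) (suc j) ∣
    A′ = + ∣ T c f (suc i) (suc j) ∣
    A″ = + ∣ T c f (suc i) j ∣

    A≤ : A ≤ A′ + A″
    A≤ = +≤+ (ℤ.∣i-j∣≤∣i∣+∣j∣ (T c f (suc i) (suc j)) (T c f (suc i) j))

    D≥0 : 0ℤ ≤ D
    D≥0 = lit d ⊗ lit e

    2xx≥0 : 0ℤ ≤ + 2 * (x * x)
    2xx≥0 = lit 2 ⊗ square x

  windows-add : Window c f (suc i) (suc j) → Window c f (suc i) j → A * (+ 2 * (x * x)) * D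
          ≤ W * children s m J
  windows-add win′ win″ = combine A A′ A″ (+ 2 * (x * x)) D W (w d′ e′ (suc j)) (w d′ e′ j)
    (s + J * (J - 1ℤ)) (J * J) (quad (s - m) (N - + 2) J) (quad (s + + 2 * (J - 1ℤ)) (N - + 2) (J - 1ℤ))
    A≤ 2xx≥0 D≥0
    (subst₂ (λ z n → A′ * (+ 2 * (x * x)) ≤ w d′ e′ (suc j) * quad z n J) (excess-inner d′ e′ j)
        (size-child d′ e′ j) win′)
    (subst₂ (λ z n → A″ * (+ 2 * (x * x)) ≤ w d′ e′ j * quad z n (+ j)) (excess-outer d′ e′ j)
        (size-child d′ e′ j) win″)
    (w-inner′ d′ e′ j) (w-outer d′ e′ j)

  window-step : Contracts s m J → Window c f (suc i) (suc j) → Window c f (suc i) j →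
          Window c f (suc (suc i)) (suc j)
  window-step contracts win′ win″ = subst (λ n → A * (+ 2 * (D * D)) ≤ W * quad s n J) (sym (size d′ e′ j))
    (ℤ.*-cancelʳ-≤-pos _ _ (x * x) (by-nonneg
      (identity A x D W (children s m J) (quad s N J))
      (D≥0 ⊗ ℤ.i≤j⇒0≤j-i (windows-add win′ win″) ⊕ w≥0 d e (suc j) ⊗ ℤ.i≤j⇒0≤j-i contracts′)))
    where
    contracts′ : D * children s m J ≤ x * x * quad s N J
    contracts′ = subst₂ (λ D x → D * children s m J ≤ x * x * quad s N J)
      (sym (product d′ e′ j)) (sym (product-child d′ e′ j)) contracts
    identity : ∀ A x D W L M → W * M * (x * x) - A * (+ 2 * (D * D)) * (x * x)
      ≡ D * (W * L - A * (+ 2 * (x * x)) * D) + W * (x * x * M - D * L)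
    identity = solve-∀

  dominated-by-windows :
    children s m J ≤ + 2 * ((s + (J - 1ℤ) * N) * (s + (J - 1ℤ) * N)) * (J - s) →
    Window c f (suc i) (suc j) → Window c f (suc i) j → Dominated c f (suc (suc i)) (suc j)
  dominated-by-windows small win′ win″ = ℤ.*-cancelʳ-≤-pos _ _ (+ 2 * (x * x)) (by-nonneg
    (identity A x D W (children s m J) (J - s))
    (ℤ.i≤j⇒0≤j-i (windows-add win′ win″) ⊕ w≥0 d e (suc j) ⊗ ℤ.i≤j⇒0≤j-i small′))
    where
    small′ : children s m J ≤ + 2 * (x * x) * (J - s)
    small′ = subst (λ x → children s m J ≤ + 2 * (x * x) * (J - s)) (sym (product-child d′ e′ j)) small
    identity : ∀ A x D W L R → W * R * (+ 2 * (x * x)) - A * D * (+ 2 * (x * x))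
      ≡ W * L - A * (+ 2 * (x * x)) * D + W * (+ 2 * (x * x) * R - L)
    identity = solve-∀

  dominated-step :
    (s + J * (J - 1ℤ)) * (- s + m + J) + J * J * (- s - J + 1ℤ) ≤ (s + (J - 1ℤ) * N) * (- s + J) →
    Dominated c f (suc i) (suc j) → Dominated c f (suc i) j → Dominated c f (suc (suc i)) (suc j)
  dominated-step adds dom′ dom″ = ℤ.*-cancelʳ-≤-pos _ _ x (by-nonneg
    (identity A x D W s J (m + J) (- s - J + 1ℤ))
    (ℤ.i≤j⇒0≤j-i both ⊕ w≥0 d e (suc j) ⊗ ℤ.i≤j⇒0≤j-i adds′))
    where
    inner : J - excess d′ e′ (suc j) ≡ - s + (m + J)
    inner = trans (cong (λ z → J - z) (excess-inner d′ e′ j)) (lemma s m J)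
      where
      lemma : ∀ s m J → J - (s - m) ≡ - s + (m + J)
      lemma = solve-∀
    outer : + j - excess d′ e′ j ≡ - s - J + 1ℤ
    outer = trans (cong (λ z → + j - z) (excess-outer d′ e′ j)) (lemma s (+ j))
      where
      lemma : ∀ s j → j - (s + + 2 * (1ℤ + j - 1ℤ)) ≡ - s - (1ℤ + j) + 1ℤ
      lemma = solve-∀
    both : A * x * D ≤ W * ((s + J * (J - 1ℤ)) * (- s + (m + J)) + J * J * (- s - J + 1ℤ))
    both = combine A A′ A″ x D W (w d′ e′ (suc j)) (w d′ e′ j)
      (s + J * (J - 1ℤ)) (J * J) (- s + (m + J)) (- s - J + 1ℤ) A≤ (lit d′ ⊗ lit e′) D≥0
      (subst (λ z → A′ * x ≤ w d′ e′ (suc j) * z) inner dom′)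
      (subst (λ z → A″ * x ≤ w d′ e′ j * z) outer dom″)
      (w-inner′ d′ e′ j) (w-outer d′ e′ j)
    adds′ : (s + J * (J - 1ℤ)) * (- s + (m + J)) + J * J * (- s - J + 1ℤ) ≤ x * (- s + J)
    adds′ = subst₂ (λ y x → (s + J * (J - 1ℤ)) * y + J * J * (- s - J + 1ℤ) ≤ x * (- s + J))
      (ℤ.+-assoc (- s) m J) (sym (product-child d′ e′ j)) adds
    identity : ∀ A x D W s J Y Z → W * (J - s) * x - A * D * x
      ≡ W * ((s + J * (J - 1ℤ)) * (- s + Y) + J * J * Z) - A * x * D
        + W * (x * (- s + J) - ((s + J * (J - 1ℤ)) * (- s + Y) + J * J * Z))
    identity = solve-∀

-- Admissible parameters in the coordinates a = d - j, b = e - j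

excess-+ : ∀ a b j → excess (j ℕ.+ a) (j ℕ.+ b) j ≡ + a * + b - + j * (+ j - 1ℤ)
excess-+ a b j = identity (+ a) (+ b) (+ j)
  where
  identity : ∀ a b j → (j + a - j) * (j + b - j) - j * (j - 1ℤ) ≡ a * b - j * (j - 1ℤ)
  identity = solve-∀

margin-+ : ∀ a b j → margin (j ℕ.+ a) (j ℕ.+ b) j ≡ + a + + b - 1ℤ
margin-+ a b j = identity (+ a) (+ b) (+ j)
  where
  identity : ∀ a b j → j + a + (j + b) - 1ℤ - + 2 * j ≡ a + b - 1ℤ
  identity = solve-∀

codegree-+ : ∀ a b j → excess (j ℕ.+ a) (j ℕ.+ b) j + + j * (+ j - 1ℤ) ≡ + a * + b
codegree-+ a b j = trans (cong (_+ + j * (+ j - 1ℤ)) (excess-+ a b j))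
    (identity (+ a * + b) (+ j * (+ j - 1ℤ)))
  where
  identity : ∀ x y → x - y + y ≡ x
  identity = solve-∀

edge-excess : ∀ b j → excess (j ℕ.+ 0) (j ℕ.+ b) j ≡ - (+ j * (+ j - 1ℤ))
edge-excess b j = trans (excess-+ 0 b j) (ℤ.+-identityˡ (- (+ j * (+ j - 1ℤ))))

module _ (a b j : ℕ) where

  private
    s = excess (j ℕ.+ suc a) (j ℕ.+ suc b) j
    m = margin (j ℕ.+ suc a) (j ℕ.+ suc b) j
    p≡ = codegree-+ (suc a) (suc b) j
    m≡ = margin-+ (suc a) (suc b) j

  margin≥1 : 1ℤ ≤ m
  margin≥1 = subst (1ℤ ≤_) (sym m≡) (by-nonneg (identity (+ a) (+ b)) (lit a ⊕ lit b))
    where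
    identity : ∀ a b → 1ℤ + a + (1ℤ + b) - 1ℤ - 1ℤ ≡ a + b
    identity = solve-∀

  margin≤codegree : m ≤ s + + j * (+ j - 1ℤ)
  margin≤codegree = subst₂ _≤_ (sym m≡) (sym p≡) (by-nonneg (identity (+ a) (+ b)) (lit a ⊗ lit b))
    where
    identity : ∀ a b → (1ℤ + a) * (1ℤ + b) - (1ℤ + a + (1ℤ + b) - 1ℤ) ≡ a * b
    identity = solve-∀

  means : + 4 * (s + + j * (+ j - 1ℤ)) ≤ (m + 1ℤ) * (m + 1ℤ)
  means = subst₂ (λ p m → + 4 * p ≤ (m + 1ℤ) * (m + 1ℤ)) (sym p≡) (sym m≡)
    (by-nonneg (identity (+ a) (+ b)) (square (+ a - + b)))
    where
    identity : ∀ a b → (1ℤ + a + (1ℤ + b) - 1ℤ + 1ℤ) * (1ℤ + a + (1ℤ + b) - 1ℤ + 1ℤ)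
            - + 4 * ((1ℤ + a) * (1ℤ + b))
      ≡ (a - b) * (a - b)
    identity = solve-∀

-- The condition j < e keeps away from the corner d = e = j, where the contraction fails.
contracts-at : ∀ d e k → let j = 2 ℕ.+ k in j ℕ.≤ d → d ℕ.≤ e → j ℕ.< e →
  Contracts (excess d e j) (margin d e j) (+ j)
contracts-at d e k j≤d d≤e j<e with ℕ.m≤n⇒∃[o]m+o≡n j≤d | ℕ.m≤n⇒∃[o]m+o≡n j<e
... | zero , refl | b , refl = subst₂ (λ s m → Contracts s m (+ j))
    (sym (trans (cong (λ e → excess (j ℕ.+ 0) e j) (sym (ℕ.+-suc j b))) (edge-excess (suc b) j)))
    (sym (trans (cong (λ e → margin (j ℕ.+ 0) e j) (sym (ℕ.+-suc j b))) (margin-+ 0 (suc b) j)))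
    (contracts-edge b k)
  where j = 2 ℕ.+ k
... | suc a , refl | b , refl = subst (λ e → Contracts (excess d e j) (margin d e j) (+ j)) (ℕ.+-suc j b)
    (contracts (excess d (j ℕ.+ suc b) j) (margin d (j ℕ.+ suc b) j) k (margin≥1 a b j)
        (margin≤codegree a b j) (means a b j))
  where j = 2 ℕ.+ k

margin+1≥0 : ∀ d e j → j ℕ.≤ d → d ℕ.≤ e → 0ℤ ≤ margin d e j + 1ℤ
margin+1≥0 d e j j≤d d≤e with ℕ.m≤n⇒∃[o]m+o≡n j≤d | ℕ.m≤n⇒∃[o]m+o≡n (ℕ.≤-trans j≤d d≤e)
... | a , refl | b , refl = subst (0ℤ ≤_) (sym
    (trans (cong (_+ 1ℤ) (margin-+ a b j)) (identity (+ a + + b)))) (lit a ⊕ lit b)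
  where
  identity : ∀ x → x - 1ℤ + 1ℤ ≡ x
  identity = solve-∀

codegree≥0 : ∀ d e j → j ℕ.≤ d → d ℕ.≤ e → 0ℤ ≤ excess d e j + + j * (+ j - 1ℤ)
codegree≥0 d e j j≤d d≤e with ℕ.m≤n⇒∃[o]m+o≡n j≤d | ℕ.m≤n⇒∃[o]m+o≡n (ℕ.≤-trans j≤d d≤e)
... | a , refl | b , refl = subst (0ℤ ≤_) (sym (codegree-+ a b j)) (lit a ⊗ lit b)

excess≥1⇒margin≤codegree : ∀ d e k → let j = suc k in j ℕ.≤ d → d ℕ.≤ e →
  1ℤ ≤ excess d e j → margin d e j ≤ excess d e j + + j * (+ j - 1ℤ)
excess≥1⇒margin≤codegree d e k j≤d d≤e 1≤s with ℕ.m≤n⇒∃[o]m+o≡n j≤d | ℕ.m≤n⇒∃[o]m+o≡n (ℕ.≤-trans j≤d d≤e)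
... | zero  , refl | b     , refl = contradiction
  (ℤ.≤-trans 1≤s (subst (_≤ 0ℤ) (sym (edge-excess b j)) (ℤ.neg-mono-≤ (lit j ⊗ lit k)))) λ { (+≤+ ()) }
  where j = suc k
... | suc a , refl | zero  , refl = contradiction (ℕ.+-cancelˡ-≤ (suc k) _ _ d≤e) λ ()
... | suc a , refl | suc b , refl = margin≤codegree a b (suc k)

-- The window bound: starting values and induction

window-two : ∀ c f k → 2 ℕ.+ k ℕ.≤ 2 ℕ.+ c → c ℕ.≤ f → Window c f 2 (2 ℕ.+ k)
window-two c f k j≤d c≤f = subst (λ n → + ∣ E₂ ∣ * (+ 2 * (D * D)) ≤ W * quad s n (+ j))
    (sym (size (suc c) (suc f) (suc k)))
  (abs-bound E₂ (+ 2 * (D * D))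
    (ℤ.*-cancelʳ-≤-pos _ _ x (subst₂ _≤_ (sym E₂-eq) (factor W x M) (*-mono-nonneg W≥0 upper)))
    (ℤ.*-cancelʳ-≤-pos _ _ x (subst₂ _≤_ (trans (neg W (+ 2 * D * U))
        (trans (cong -_ (sym E₂-eq)) (ℤ.neg-distribˡ-* (E₂ * (+ 2 * (D * D))) x)))
      (factor W x M) (*-mono-nonneg W≥0 lower))))
  where
  d = 2 ℕ.+ c
  e = 2 ℕ.+ f
  j = 2 ℕ.+ k
  s = excess d e j
  m = margin d e j
  D = + d * + e
  x = + suc c * + suc f
  E₂ = T c f 2 j
  W = w d e j
  U = second s m (+ j)
  M = quad s (m + + 2 * + j) (+ j)
  W≥0 = w≥0 d e j
  u = m + 1ℤ
  factor : ∀ W x M → W * (x * M) ≡ W * M * x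
  factor = solve-∀
  neg : ∀ W z → W * - z ≡ - (W * z)
  neg = solve-∀
  E₂-eq : E₂ * (+ 2 * (D * D)) * x ≡ W * (+ 2 * D * U)
  E₂-eq = begin
    E₂ * (+ 2 * (D * D)) * x  ≡⟨ left E₂ D x ⟩
    + 2 * D * (D * x * E₂)    ≡⟨ cong (λ z → + 2 * D * z) (D*x*T-two c f k) ⟩
    + 2 * D * (U * W)         ≡⟨ right D U W ⟩
    W * (+ 2 * D * U)         ∎
    where
    open ≡-Reasoning
    left : ∀ E D x → E * (+ 2 * (D * D)) * x ≡ + 2 * D * (D * x * E)
    left = solve-∀
    right : ∀ D U W → + 2 * D * (U * W) ≡ W * (+ 2 * D * U)
    right = solve-∀
  d≤e = ℕ.s≤s (ℕ.s≤s c≤f)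
  u≥0 = margin+1≥0 d e j j≤d d≤e
  p≥0 = codegree≥0 d e j j≤d d≤e
  u-1≡m : u - 1ℤ ≡ m
  u-1≡m = identity m
    where
    identity : ∀ m → m + 1ℤ - 1ℤ ≡ m
    identity = solve-∀
  upper : + 2 * D * U ≤ x * M
  upper = subst₂ (λ D x → + 2 * D * U ≤ x * M) (sym (product (suc c) (suc f) (suc k)))
      (sym (product-child (suc c) (suc f) (suc k)))
    (subst (λ m → let N = m + + 2 * + j in + 2 * (s + + j * N) * second s m
        (+ j) ≤ (s + (+ j - 1ℤ) * N) * quad s N (+ j)) u-1≡m
      (second-upper s u k u≥0 p≥0))
  lower : - (+ 2 * D * U) ≤ x * M
  lower = subst₂ (λ D x → - (+ 2 * D * U) ≤ x * M) (sym (product (suc c) (suc f) (suc k)))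
      (sym (product-child (suc c) (suc f) (suc k)))
    (subst (λ m → let N = m + + 2 * + j in - (+ 2 * (s + + j * N) * second s m
        (+ j)) ≤ (s + (+ j - 1ℤ) * N) * quad s N (+ j)) u-1≡m
      (second-lower s u k u≥0 p≥0
        (subst (λ m → 1ℤ ≤ s → m ≤ s + + j * (+ j - 1ℤ)) (sym u-1≡m)
            (excess≥1⇒margin≤codegree d e (suc k) j≤d d≤e))))

window-one : ∀ c f i → 4 ℕ.≤ 2 ℕ.+ i ℕ.+ f → Window c f (2 ℕ.+ i) 1
window-one c f i 4≤e = subst₂ (λ t W → + ∣ t ∣ * (+ 2 * (D * D)) ≤ W * M) (sym (T-one c f (2 ℕ.+ i))) W≡D
    (ℤ.≤-trans (ℤ.≤-reflexive (left (+ ∣ t ∣) D))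
      (*-mono-nonneg (lit d ⊗ lit e) (abs-bound t (+ 2 * D)
        (ℤ.≤-trans (ℤ.≤-reflexive (ℤ.*-comm t (+ 2 * D)))
          (ℤ.≤-trans (one-upper (+ i) (+ c) (+ f) (lit i) (lit c) (lit f)) (ℤ.≤-reflexive M≡)))
        (ℤ.≤-trans (by-nonneg (right (+ i) (+ c) (+ f)) (lit 2 ⊗ (lit d ⊗ lit e) ⊗ (lit c ⊕ lit c ⊗ lit f)))
          (ℤ.≤-trans lower (ℤ.≤-reflexive M≡))))))
  where
  d = 2 ℕ.+ i ℕ.+ c
  e = 2 ℕ.+ i ℕ.+ f
  D = + d * + e
  t = + c * + f - + (2 ℕ.+ i)
  M = quad (excess d e 1) (+ d + + e - 1ℤ) 1ℤ
  W≡D : D ≡ w d e 1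
  W≡D = cong₂ (λ y z → + y * + z) (sym (nC1≡n d)) (sym (nC1≡n e))
  left : ∀ t D → t * (+ 2 * (D * D)) ≡ D * (t * (+ 2 * D))
  left = solve-∀
  right : ∀ i c f → let d = + 2 + i + c ; e = + 2 + i + f in
    + 2 * (d * e) * d - - ((c * f - (+ 2 + i)) * (+ 2 * (d * e))) ≡ + 2 * (d * e) * (c + c * f)
  right = solve-∀
  M≡ : + 2 * ((+ d - 1ℤ) * (+ e - 1ℤ) * ((+ d - 1ℤ) * (+ e - 1ℤ))) + + 3 * (+ d + + e - 1ℤ) ≡ M
  M≡ = identity (+ d) (+ e)
    where
    identity : ∀ d e → let s = (d - 1ℤ) * (e - 1ℤ) - 1ℤ * (1ℤ - 1ℤ) in
      + 2 * ((d - 1ℤ) * (e - 1ℤ) * ((d - 1ℤ) * (e - 1ℤ))) + + 3 * (d + e - 1ℤ)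
      ≡ + 2 * (s * s) + + 3 * (1ℤ * 1ℤ) * (d + e - 1ℤ)
    identity = solve-∀
  lower : + 2 * (+ d * + e) * + d ≤ + 2 * ((+ d - 1ℤ) * (+ e - 1ℤ) * ((+ d - 1ℤ) * (+ e - 1ℤ)))
          + + 3 * (+ d + + e - 1ℤ)
  lower with ℕ.m≤n⇒∃[o]m+o≡n 4≤e
  ... | b , 4+b≡e = subst (λ e → + 2 * (+ d * e) * + d ≤ + 2 * ((+ d - 1ℤ) * (e - 1ℤ) * ((+ d - 1ℤ) * (e - 1ℤ))) + + 3 * (+ d + e - 1ℤ))
    (cong +_ 4+b≡e) (one-lower (+ (i ℕ.+ c)) (+ b) (lit (i ℕ.+ c)) (lit b))

-- The leading coefficient of (1 - x)^i Σ C(c,l) C(f,l) x^l is C(f,c) up to sign, provided by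
-- `T c f i (i + c)` at each step.
∣T-top∣ : ∀ c f i → ∣ T c f i (i ℕ.+ c) ∣ ≡ f C c
∣T-top∣ c f zero = trans (cong (λ z → ∣ + z * + (f C c) ∣) (nCn≡1 c)) (cong ∣_∣ (ℤ.*-identityˡ (+ (f C c))))
∣T-top∣ c f (suc i) rewrite k>c+i⇒T≡0 c f i (ℕ.n<1+n (i ℕ.+ c)) =
  trans (cong ∣_∣ (ℤ.+-identityˡ (- T c f i (i ℕ.+ c))))
      (trans (ℤ.∣-i∣≡∣i∣ (T c f i (i ℕ.+ c))) (∣T-top∣ c f i))

-- At d = e = j there is no contraction, but the eigenvalue is 1 or -1 and the valency 1, so the
-- bound is verified directly.
window-corner : ∀ c i → 1 ℕ.≤ i → Window c c i (i ℕ.+ c)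
window-corner c i@(suc i′) _ = subst₂ (λ t W → + t * (+ 2 * (D * D)) ≤ W * quad (excess d d d)
    (+ d + + d - 1ℤ) (+ d))
  (sym (trans (∣T-top∣ c c i) (nCn≡1 c))) (sym (cong₂ (λ y z → + y * + z) (nCn≡1 d) (nCn≡1 d)))
  (by-nonneg (identity (+ (i′ ℕ.+ c))) ((lit d ⊗ lit d) ⊗ (lit 1 ⊕ lit 2 ⊗ lit (i′ ℕ.+ c))))
  where
  d = i ℕ.+ c
  D = + d * + d
  identity : ∀ y → let d = 1ℤ + y ; s = (d - d) * (d - d) - d * (d - 1ℤ) in
    1ℤ * 1ℤ * (+ 2 * (s * s) + + 3 * (d * d) * (d + d - 1ℤ)) - 1ℤ * (+ 2 * (d * d * (d * d)))
    ≡ d * d * (1ℤ + + 2 * y)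
  identity = solve-∀

window? : ∀ c f i j → Dec (Window c f i j)
window? c f i j = + ∣ T c f i j ∣ * (+ 2 * (D * D)) ℤ.≤? w d e j * quad (excess d e j) (+ d + + e
        - 1ℤ) (+ j)
  where d = i ℕ.+ c ; e = i ℕ.+ f ; D = + d * + e

-- For j = 2 and e ≤ 4 the second child has j = 1 and e - 1 ≤ 3, out of reach of `window-one`; the
-- few cases are evaluated.
window-small : ∀ c f i → c ℕ.≤ f → i ℕ.+ f ℕ.≤ 1 → Window c f (3 ℕ.+ i) 2
window-small zero       zero          zero          _ _ = from-yes (window? 0 0 3 2)
window-small zero       zero          (suc zero)    _ _ = from-yes (window? 0 0 4 2)
window-small zero       (suc zero)    zero          _ _ = from-yes (window? 0 1 3 2)
window-small (suc zero) (suc zero)    zero          _ _ = from-yes (window? 1 1 3 2)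
window-small _          zero          (suc (suc i)) _ (ℕ.s≤s ())
window-small _          (suc (suc f)) zero          _ (ℕ.s≤s ())
window-small _          (suc f)       (suc i)       _ (ℕ.s≤s i+1+f≤0) = contradiction
    (ℕ.m+n≤o⇒n≤o i i+1+f≤0) λ ()
window-small (suc (suc c)) (suc zero) zero (ℕ.s≤s ()) _

-- For j = 1 the bound fails when (d,e) is (2,2), (2,3) or (3,3).
window : ∀ c f → c ℕ.≤ f → ∀ i j → 1 ℕ.≤ j ⊎ 4 ℕ.≤ 2 ℕ.+ i ℕ.+ f → Window c f (2 ℕ.+ i) (suc j)
window c f c≤f i zero (inj₂ 4≤e) = window-one c f i 4≤e
window c f c≤f i (suc k) _ with 2 ℕ.+ k ℕ.≤? 2 ℕ.+ i ℕ.+ c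
... | no  j≰d = outside c f (2 ℕ.+ i) (+ 2 * (D * D)) (quad (excess d e (2 ℕ.+ k)) (+ d + + e
        - 1ℤ) (+ (2 ℕ.+ k))) (ℕ.≰⇒> j≰d)
  where
  d = 2 ℕ.+ i ℕ.+ c
  e = 2 ℕ.+ i ℕ.+ f
  D = + d * + e
window c f c≤f zero    (suc k) _ | yes j≤d = window-two c f k j≤d c≤f
window c f c≤f (suc i) (suc k) _ | yes j≤d with 2 ℕ.+ k ℕ.<? 3 ℕ.+ i ℕ.+ f
... | no  j≮e = subst₂ (λ f j → Window c f (3 ℕ.+ i) j) c≡f d≡j (window-corner c (3 ℕ.+ i) (ℕ.s≤s ℕ.z≤n))
  where
  e≤j = ℕ.≮⇒≥ j≮e
  d≤e = ℕ.+-monoʳ-≤ (3 ℕ.+ i) c≤f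
  d≡j = ℕ.≤-antisym (ℕ.≤-trans d≤e e≤j) j≤d
  c≡f = ℕ.≤-antisym c≤f (ℕ.+-cancelˡ-≤ (3 ℕ.+ i) _ _ (ℕ.≤-trans e≤j j≤d))
... | yes j<e = go k j≤d j<e
  where
  step : ∀ k → 2 ℕ.+ k ℕ.≤ 3 ℕ.+ i ℕ.+ c → 2 ℕ.+ k ℕ.< 3 ℕ.+ i ℕ.+ f →
    1 ℕ.≤ k ⊎ 4 ℕ.≤ 2 ℕ.+ i ℕ.+ f → Window c f (3 ℕ.+ i) (2 ℕ.+ k)
  step k j≤d j<e reg = window-step c f (suc i) (suc k)
    (contracts-at (3 ℕ.+ i ℕ.+ c) (3 ℕ.+ i ℕ.+ f) k j≤d (ℕ.+-monoʳ-≤ (3 ℕ.+ i) c≤f) j<e)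
    (window c f c≤f i (suc k) (inj₁ (ℕ.s≤s ℕ.z≤n))) (window c f c≤f i k reg)
  go : ∀ k → 2 ℕ.+ k ℕ.≤ 3 ℕ.+ i ℕ.+ c → 2 ℕ.+ k ℕ.< 3 ℕ.+ i ℕ.+ f → Window c f (3 ℕ.+ i) (2 ℕ.+ k)
  go (suc k) j≤d j<e = step (suc k) j≤d j<e (inj₁ (ℕ.s≤s ℕ.z≤n))
  -- The second child now has j = 1, and its bound requires e - 1 ≥ 4.
  go zero    j≤d j<e with 4 ℕ.≤? 2 ℕ.+ i ℕ.+ f
  ... | yes 4≤e = step zero j≤d j<e (inj₂ 4≤e)
  ... | no  4≰e = window-small c f i c≤f (ℕ.s≤s⁻¹ (ℕ.s≤s⁻¹ (ℕ.s≤s⁻¹ (ℕ.≰⇒> 4≰e))))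

-- Covering the critical strip

Critical : (s m j : ℤ) → Set
Critical s m j = children s m j ≤ + 2 * ((s + (j - 1ℤ) * N) * (s + (j - 1ℤ) * N)) * (j - s)
  where N = m + + 2 * j

critical? : ∀ s m j → Dec (Critical s m j)
critical? s m j = children s m j ℤ.≤? + 2 * ((s + (j - 1ℤ) * N) * (s + (j - 1ℤ) * N)) * (j - s)
  where N = m + + 2 * j

critical-core : ∀ s m k → let j = + 3 + + k in
  0ℤ ≤ m → + 4 * (s + j * (j - 1ℤ)) ≤ (m + 1ℤ) * (m + 1ℤ) → s ≤ 0ℤ → - s ≤ + 3 + + 2 * + k →
  (s ≡ 0ℤ × k ≡ 0) ⊎ Critical s m j
critical-core (+ zero) m zero m≥0 means _ _ = inj₁ (refl , refl)
critical-core (+ suc n) m k m≥0 means (+≤+ ()) _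
critical-core (+ zero) m (suc k) m≥0 means _ _ = inj₂
  (subst (λ m → Critical 0ℤ m (+ 4 + + k)) (sym (shift (+ 6 + + 2 * + k) m))
    (critical-zero (m - (+ 6 + + 2 * + k)) (+ k) (ℤ.i≤j⇒0≤j-i m≥) (lit k)))
  where
  identity : ∀ k → + 4 * (0ℤ + (+ 4 + k) * (+ 4 + k - 1ℤ)) - (1ℤ + (+ 6 + + 2 * k) * (+ 6 + + 2 * k))
          ≡ + 11 + + 4 * k
  identity = solve-∀
  -- Here (2 j - 2)² < 4 j (j-1) ≤ (m + 1)².
  m≥ : + 6 + + 2 * + k ≤ m
  m≥ = 1+square-reflects-≤ (ℤ.+-mono-≤ {1ℤ} {+ 6} (+≤+ (ℕ.s≤s ℕ.z≤n)) (lit 2 ⊗ lit k)) m≥0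
    (ℤ.≤-trans (by-nonneg (identity (+ k)) (lit 11 ⊕ lit 4 ⊗ lit k)) means)
critical-core -[1+ n ] m k m≥0 means _ -s≤ = inj₂
  (subst (λ m → Critical -[1+ n ] m (+ 3 + + k)) (sym (shift (+ 2 + + 2 * + k) m))
    (critical-pos (+ n) (m - (+ 2 + + 2 * + k)) (+ k) (lit n) (ℤ.i≤j⇒0≤j-i m≥) (lit k) τ≥0))
  where
  rearrange : ∀ n k → + 3 + + 2 * k - (1ℤ + n) ≡ + 2 * k + + 2 - n
  rearrange = solve-∀
  τ≥0 : 0ℤ ≤ + 2 * + k + + 2 - + n
  τ≥0 = subst (0ℤ ≤_) (rearrange (+ n) (+ k)) (ℤ.i≤j⇒0≤j-i -s≤)
  identity : ∀ n k → + 4 * (- (1ℤ + n) + (+ 3 + k) * (+ 3 + k - 1ℤ))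
          - (1ℤ + (+ 2 + + 2 * k) * (+ 2 + + 2 * k))
    ≡ + 4 * (+ 2 * k + + 2 - n) + + 7 + + 4 * k
  identity = solve-∀
  m≥ : + 2 + + 2 * + k ≤ m
  m≥ = 1+square-reflects-≤ (ℤ.+-mono-≤ {1ℤ} {+ 2} (+≤+ (ℕ.s≤s ℕ.z≤n)) (lit 2 ⊗ lit k)) m≥0
    (ℤ.≤-trans (by-nonneg (identity (+ n) (+ k)) (lit 4 ⊗ τ≥0 ⊕ lit 7 ⊕ lit 4 ⊗ lit k)) means)

-- For s = 0 and j = 3 one has (d - 3)(e - 3) = 6, which leaves (d,e) = (4,9) and (5,6).
factors-of-six : ∀ a b → a ℕ.≤ b → suc a ℕ.* suc b ≡ 6 → (a ≡ 0 × b ≡ 5) ⊎ (a ≡ 1 × b ≡ 2)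
factors-of-six 0 b _ eq = inj₁ (refl , ℕ.suc-injective (trans (sym (ℕ.*-identityˡ (suc b))) eq))
factors-of-six 1 b _ eq = inj₂ (refl , ℕ.suc-injective (ℕ.*-cancelˡ-≡ (suc b) 3 2 eq))
factors-of-six (suc (suc a)) b a≤b eq = contradiction
  (subst (9 ℕ.≤_) eq (ℕ.*-mono-≤ {3} {3 ℕ.+ a} {3} (ℕ.s≤s (ℕ.s≤s (ℕ.s≤s ℕ.z≤n)))
      (ℕ.s≤s (ℕ.≤-trans (ℕ.s≤s (ℕ.s≤s ℕ.z≤n)) a≤b))))
  λ { (ℕ.s≤s (ℕ.s≤s (ℕ.s≤s (ℕ.s≤s (ℕ.s≤s (ℕ.s≤s ())))))) }

critical-at : ∀ d e k → let j = 3 ℕ.+ k in j ℕ.≤ d → d ℕ.≤ e →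
  excess d e j ≤ 0ℤ → - excess d e j ≤ + 3 + + 2 * + k →
  (k ≡ 0 × d ≡ 5 × e ≡ 6) ⊎ Critical (excess d e j) (margin d e j) (+ j)
critical-at d e k j≤d d≤e s≤0 -s≤ with ℕ.m≤n⇒∃[o]m+o≡n j≤d | ℕ.m≤n⇒∃[o]m+o≡n (ℕ.≤-trans j≤d d≤e)
-- For d = j ≥ 3 the value s = - j (j-1) lies below the strip.
... | zero , refl | b , refl = contradiction (ℤ.i≤j⇒0≤j-i -s≤)
    (subst (λ z → 0ℤ ≤ z → ⊥) (sym negative) λ ())
  where
  j = 3 ℕ.+ k
  identity : ∀ k → + 3 + + 2 * k - - (- ((+ 3 + k) * (+ 3 + k - 1ℤ))) ≡ - (+ 3 + k * (+ 3 + k))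
  identity = solve-∀
  negative : + 3 + + 2 * + k - - excess (j ℕ.+ 0) (j ℕ.+ b) j ≡ -[1+ 2 ℕ.+ k ℕ.* (3 ℕ.+ k) ]
  negative = trans (cong (λ z → + 3 + + 2 * + k - - z) (edge-excess b j))
    (trans (identity (+ k)) (cong (λ z → - (+ 3 + z)) (sym (pos-* k (3 ℕ.+ k)))))
... | suc a , refl | zero , refl = contradiction (ℕ.+-cancelˡ-≤ (3 ℕ.+ k) _ _ d≤e) λ ()
... | suc a , refl | suc b , refl with critical-core (excess d e j) (margin d e j) k
      (ℤ.≤-trans (lit 1) (margin≥1 a b j)) (means a b j) s≤0 -s≤
  where j = 3 ℕ.+ k
... | inj₂ crit = inj₂ crit
... | inj₁ (s≡0 , refl) with factors-of-six a b (ℕ.s≤s⁻¹ (ℕ.+-cancelˡ-≤ 3 _ _ d≤e)) ab≡6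
  where
  ab≡6 : suc a ℕ.* suc b ≡ 6
  ab≡6 = ℤ.+-injective (trans (pos-* (suc a) (suc b))
      (trans (sym (codegree-+ (suc a) (suc b) 3)) (cong (_+ + 6) s≡0)))
... | inj₁ (refl , refl) = inj₂ (from-yes (critical? (+ 0) (+ 6) (+ 3)))
-- At (5,6) the children's bounds add up to 2640 against 2400, so this case is left to direct
-- evaluation.
... | inj₂ (refl , refl) = inj₁ (refl , refl , refl)

dominated? : ∀ c f i j → Dec (Dominated c f i j)
dominated? c f i j = + ∣ T c f i j ∣ * (+ d * + e) ℤ.≤? w d e j * (+ j - excess d e j)
  where d = i ℕ.+ c ; e = i ℕ.+ f

dominated-one : ∀ c f j → excess (suc c) (suc f) (suc j) ≤ 0ℤ → Dominated c f 1 (suc j)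
dominated-one c f j s≤0 = abs-bound E₁ D
  (subst (_≤ W * (J - s)) (sym E₁D) (by-nonneg (identity s W J)
      (lit 2 ⊗ (W≥0 ⊗ (lit (suc j) ⊕ ℤ.neg-mono-≤ s≤0)))))
  (ℤ.≤-reflexive (trans (cong -_ E₁D) (flip s W J)))
  where
  d = suc c
  e = suc f
  J = + suc j
  s = excess d e (suc j)
  W = w d e (suc j)
  W≥0 = w≥0 d e (suc j)
  D = + d * + e
  E₁ = T c f 1 (suc j)
  E₁D : E₁ * D ≡ (s - J) * W
  E₁D = trans (ℤ.*-comm E₁ D) (D*T-one c f j)
  identity : ∀ s W J → W * (J - s) - (s - J) * W ≡ + 2 * (W * (J + - s))
  identity = solve-∀
  flip : ∀ s W J → - ((s - J) * W) ≡ W * (J - s)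
  flip = solve-∀

dominated-two : ∀ c f k → let d = 2 ℕ.+ c ; e = 2 ℕ.+ f ; j = 2 ℕ.+ k in j ℕ.≤ d → c ℕ.≤ f →
  excess d e j ≤ 0ℤ → - excess d e j ≤ + 2 * + k + + 2 → Dominated c f 2 j
dominated-two c f k j≤d c≤f s≤0 -s≤ = abs-bound E₂ D
  (ℤ.*-cancelʳ-≤-pos _ _ x (subst₂ _≤_ (sym E₂D) (swap W x (+ j - s)) (*-mono-nonneg (w≥0 d e j) upper)))
  (ℤ.*-cancelʳ-≤-pos _ _ x (subst₂ _≤_ (trans (neg W U)
      (trans (cong -_ (sym E₂D)) (ℤ.neg-distribˡ-* (E₂ * D) x)))
    (swap W x (+ j - s)) (*-mono-nonneg (w≥0 d e j)
        (subst (- U ≤_) (ℤ.neg-involutive (x * (+ j - s))) (ℤ.neg-mono-≤ lower)))))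
  where
  d = 2 ℕ.+ c
  e = 2 ℕ.+ f
  j = 2 ℕ.+ k
  s = excess d e j
  m = margin d e j
  u = m + 1ℤ
  W = w d e j
  U = second s m (+ j)
  D = + d * + e
  x = + suc c * + suc f
  E₂ = T c f 2 j
  swap : ∀ W x y → W * (x * y) ≡ W * y * x
  swap = solve-∀
  neg : ∀ W z → W * - z ≡ - (W * z)
  neg = solve-∀
  E₂D : E₂ * D * x ≡ W * U
  E₂D = trans (commute E₂ D x) (trans (D*x*T-two c f k) (ℤ.*-comm U W))
    where
    commute : ∀ E D x → E * D * x ≡ D * x * E
    commute = solve-∀
  u-1≡m : u - 1ℤ ≡ m
  u-1≡m = identity m
    where
    identity : ∀ m → m + 1ℤ - 1ℤ ≡ m
    identity = solve-∀
  u≥0 = margin+1≥0 d e j j≤d (ℕ.s≤s (ℕ.s≤s c≤f))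
  S≥0 = ℤ.neg-mono-≤ s≤0
  upper : U ≤ x * (+ j - s)
  upper = subst (λ x → U ≤ x * (+ j - s)) (sym (product-child (suc c) (suc f) (suc k)))
    (subst₂ (λ s m → second s m (+ j) ≤ (s + (+ j - 1ℤ) * (m + + 2 * + j)) * (+ j - s))
        (ℤ.neg-involutive s) u-1≡m
      (second-critical-upper (- s) u (+ k) S≥0 u≥0 (lit k) (ℤ.i≤j⇒0≤j-i -s≤)))
  lower : - (x * (+ j - s)) ≤ U
  lower = subst (λ x → - (x * (+ j - s)) ≤ U) (sym (product-child (suc c) (suc f) (suc k)))
    (subst₂ (λ s m → - ((s + (+ j - 1ℤ) * (m + + 2 * + j)) * (+ j - s)) ≤ second s m (+ j))
        (ℤ.neg-involutive s) u-1≡m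
      (second-critical-lower (- s) u (+ k) S≥0 u≥0 (lit k)))

-- `S` stands for - s. The factors `S + m + j` and `S - j + 1ℤ` are the values of j - s at the two
-- children.
Adds : (s S m j : ℤ) → Set
Adds s S m j = (s + j * (j - 1ℤ)) * (S + m + j) + j * j * (S - j + 1ℤ)
        ≤ (s + (j - 1ℤ) * (m + + 2 * j)) * (S + j)

adds-at : ∀ d e k → let j = suc k in j ℕ.≤ d → d ℕ.≤ e → excess d e j ≤ 0ℤ →
  Adds (excess d e j) (- excess d e j) (margin d e j) (+ j)
adds-at d e k j≤d d≤e s≤0 with ℕ.m≤n⇒∃[o]m+o≡n j≤d | ℕ.m≤n⇒∃[o]m+o≡n (ℕ.≤-trans j≤d d≤e)
... | zero , refl | b , refl = subst₂ (λ s m → Adds s (- s) m (+ j)) (sym (edge-excess b j))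
    (sym (margin-+ 0 b j))
    (subst (λ S → Adds (- (+ j * + k)) S (+ b - 1ℤ) (+ j)) (sym (ℤ.neg-involutive (+ j * + k)))
        (adds-edge (+ b) (+ k) (lit b) (lit k)))
  where j = suc k
... | suc a , refl | zero , refl = contradiction (ℕ.+-cancelˡ-≤ (suc k) _ _ d≤e) λ ()
... | suc a , refl | suc b , refl =
    subst₂ (λ s′ m → Adds s′ (- s) m (+ j)) (ℤ.neg-involutive s) (sym (shift 1ℤ m))
      (adds-inner (- s) (m - 1ℤ) (+ k) (ℤ.neg-mono-≤ s≤0) (ℤ.i≤j⇒0≤j-i (margin≥1 a b j)) (lit k))
  where
  j = suc k
  s = excess d e j
  m = margin d e j

excess-mono : ∀ d e j → suc j ℕ.≤ d → suc j ℕ.≤ e → excess d e (suc j) ≤ excess (suc d) (suc e) (suc j)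
excess-mono d e j j<d j<e with ℕ.m≤n⇒∃[o]m+o≡n j<d | ℕ.m≤n⇒∃[o]m+o≡n j<e
... | a , refl | b , refl = by-nonneg (identity (+ a) (+ b) (+ suc j)) (lit a ⊕ lit b ⊕ lit 1)
  where
  identity : ∀ a b j →
    (1ℤ + (j + a) - j) * (1ℤ + (j + b) - j) - j * (j - 1ℤ) - ((j + a - j) * (j + b - j) - j * (j - 1ℤ))
            ≡ a + b + 1ℤ
  identity = solve-∀

-- For j = 2, s ≤ 0 means (d - 2)(e - 2) ≤ 2. The children with j = 1 then have (d,e) = (2,2) or
-- (2,3), exceptions of the window bound, so the eigenvalues are computed.
dominated-small : ∀ c f i → c ℕ.≤ f → suc (i ℕ.+ c) ℕ.* suc (i ℕ.+ f) ℕ.≤ 2 → Dominated c f (3 ℕ.+ i) 2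
dominated-small zero    zero       zero    _ _ = from-yes (dominated? 0 0 3 2)
dominated-small zero    (suc zero) zero    _ _ = from-yes (dominated? 0 1 3 2)
dominated-small zero    (suc (suc f)) zero _ (ℕ.s≤s (ℕ.s≤s ()))
dominated-small (suc c) (suc f)    zero    _ ab≤2 = contradiction
  (ℕ.≤-trans (ℕ.*-mono-≤ {2} {2 ℕ.+ c} {2} (ℕ.s≤s (ℕ.s≤s ℕ.z≤n))
      (ℕ.s≤s (ℕ.s≤s ℕ.z≤n))) ab≤2) λ { (ℕ.s≤s (ℕ.s≤s ())) }
dominated-small c       f          (suc i) _ ab≤2 = contradiction
  (ℕ.≤-trans (ℕ.*-mono-≤ {2} {2 ℕ.+ i ℕ.+ c} {2} (ℕ.s≤s (ℕ.s≤s ℕ.z≤n))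
      (ℕ.s≤s (ℕ.s≤s ℕ.z≤n))) ab≤2) λ { (ℕ.s≤s (ℕ.s≤s ())) }

dominated-5-6 : ∀ c f i → 3 ℕ.+ i ℕ.+ c ≡ 5 → 3 ℕ.+ i ℕ.+ f ≡ 6 → Dominated c f (3 ℕ.+ i) 3
dominated-5-6 .2 .3 0 refl refl = from-yes (dominated? 2 3 3 3)
dominated-5-6 .1 .2 1 refl refl = from-yes (dominated? 1 2 4 3)
dominated-5-6 .0 .1 2 refl refl = from-yes (dominated? 0 1 5 3)

-- Outside the strip the induction hypothesis is applied to both children. Inside it `window` at i -
-- 1 takes over; as that bound starts at 2, the case i = 2 uses the explicit E_j(2).
dominated : ∀ c f → c ℕ.≤ f → ∀ i j → suc j ℕ.≤ suc i ℕ.+ c → excess (suc i ℕ.+ c) (suc i ℕ.+ f) (suc j)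
        ≤ 0ℤ →
  Dominated c f (suc i) (suc j)
dominated c f c≤f zero j _ s≤0 = dominated-one c f j s≤0
-- For j = 1 and d ≥ 2, s = (d - 1)(e - 1) is positive.
dominated c f c≤f (suc i) zero _ (+≤+ ())
dominated c f c≤f (suc i) (suc k) j≤d s≤0
  with + 2 * (+ (2 ℕ.+ k) - 1ℤ) ℤ.≤? - excess (2 ℕ.+ i ℕ.+ c) (2 ℕ.+ i ℕ.+ f) (2 ℕ.+ k)
... | yes 2j-2≤-s = dominated-step c f i (suc k) (adds-at d e (suc k) j≤d d≤e s≤0) inner outer
  where
  d = 2 ℕ.+ i ℕ.+ c
  e = 2 ℕ.+ i ℕ.+ f
  j = 2 ℕ.+ k
  s = excess d e j
  d≤e = ℕ.+-monoʳ-≤ (2 ℕ.+ i) c≤f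
  inner : Dominated c f (suc i) j
  inner with j ℕ.≤? suc i ℕ.+ c
  ... | yes j≤d′ = dominated c f c≤f i (suc k) j≤d′
        (ℤ.≤-trans (excess-mono (suc i ℕ.+ c) (suc i ℕ.+ f) (suc k) j≤d′
            (ℕ.≤-trans j≤d′ (ℕ.+-monoʳ-≤ (suc i) c≤f))) s≤0)
  ... | no  j≰d′ = outside c f (suc i) (+ (suc i ℕ.+ c) * + (suc i ℕ.+ f)) (+ j
          - excess (suc i ℕ.+ c) (suc i ℕ.+ f) j) (ℕ.≰⇒> j≰d′)
  outer : Dominated c f (suc i) (suc k)
  outer = dominated c f c≤f i k (ℕ.s≤s⁻¹ j≤d)
      (subst (_≤ 0ℤ) (sym (excess-outer (suc i ℕ.+ c) (suc i ℕ.+ f) (suc k)))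
    (by-nonneg (identity s (+ 2 * (+ j - 1ℤ))) (ℤ.i≤j⇒0≤j-i 2j-2≤-s)))
    where
    identity : ∀ s y → 0ℤ - (s + y) ≡ - s - y
    identity = solve-∀
dominated c f c≤f (suc i) (suc k) j≤d s≤0 | no 2j-2≰-s = go i k j≤d s≤0 (ℤ.i<j⇒i≤pred[j] (ℤ.≰⇒> 2j-2≰-s))
  where
  go : ∀ i k → let d = 2 ℕ.+ i ℕ.+ c ; e = 2 ℕ.+ i ℕ.+ f ; j = 2 ℕ.+ k in
    j ℕ.≤ d → excess d e j ≤ 0ℤ → - excess d e j ≤ -1ℤ + + 2 * (+ j - 1ℤ) → Dominated c f (2 ℕ.+ i) j
  go zero k j≤d s≤0 -s≤ = dominated-two c f k j≤d c≤f s≤0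
      (ℤ.≤-trans -s≤ (by-nonneg (identity (+ k)) (lit 1)))
    where
    identity : ∀ k → + 2 * k + + 2 - (-1ℤ + + 2 * (+ 2 + k - 1ℤ)) ≡ 1ℤ
    identity = solve-∀
  go (suc i) zero j≤d s≤0 -s≤ = dominated-small c f i c≤f (ℤ.drop‿+≤+
    (subst₂ _≤_ (trans (codegree-+ (suc (i ℕ.+ c)) (suc (i ℕ.+ f)) 2)
        (sym (pos-* (suc (i ℕ.+ c)) (suc (i ℕ.+ f)))))
      refl (ℤ.+-monoˡ-≤ (+ 2) s≤0)))
  go (suc i) (suc k) j≤d s≤0 -s≤ with critical-at (3 ℕ.+ i ℕ.+ c) (3 ℕ.+ i ℕ.+ f) k j≤d
      (ℕ.+-monoʳ-≤ (3 ℕ.+ i) c≤f) s≤0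
      (ℤ.≤-trans -s≤ (ℤ.≤-reflexive (identity (+ k))))
    where
    identity : ∀ k → -1ℤ + + 2 * (+ 3 + k - 1ℤ) ≡ + 3 + + 2 * k
    identity = solve-∀
  ... | inj₁ (refl , d≡5 , e≡6) = dominated-5-6 c f i d≡5 e≡6
  ... | inj₂ crit = dominated-by-windows c f (suc i) (2 ℕ.+ k) crit
      (window c f c≤f i (2 ℕ.+ k) (inj₁ (ℕ.s≤s ℕ.z≤n))) (window c f c≤f i (suc k) (inj₁ (ℕ.s≤s ℕ.z≤n)))

-- Necessity of the condition, and the theorem

nCk>0 : ∀ n k → k ℕ.≤ n → 1 ℕ.≤ n C k
nCk>0 n       zero    _           = ℕ.≤-refl
nCk>0 (suc n) (suc k) (ℕ.s≤s k≤n) = subst (1 ℕ.≤_) (nCk+nC[k+1]≡[n+1]C[k+1] n k)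
    (ℕ.m≤n⇒m≤n+o _ (nCk>0 n k k≤n))

infixl 7 _⊛_

_⊛_ : ∀ {x y} → 1ℤ ≤ x → 1ℤ ≤ y → 1ℤ ≤ x * y
_⊛_ {x} {y} x≥1 y≥1 = by-nonneg (identity x y)
  (ℤ.i≤j⇒0≤j-i x≥1 ⊗ ℤ.i≤j⇒0≤j-i y≥1 ⊕ ℤ.i≤j⇒0≤j-i x≥1 ⊕ ℤ.i≤j⇒0≤j-i y≥1)
  where
  identity : ∀ x y → x * y - 1ℤ ≡ (x - 1ℤ) * (y - 1ℤ) + (x - 1ℤ) + (y - 1ℤ)
  identity = solve-∀

-- For j ≥ 2, d e (d-1)(e-1) (E_j(2) - E_j(1)) = - s j (n-2) w, and the factor j (n-2) w is
-- positive. For j = 1, E_1(2) < E_1(1) outright.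
smallest⇒excess≤0 : ∀ c f j → suc j ℕ.≤ 2 ℕ.+ c → c ℕ.≤ f → T (suc c) (suc f) 1 (suc j)
        ≤ T c f 2 (suc j) →
  excess (2 ℕ.+ c) (2 ℕ.+ f) (suc j) ≤ 0ℤ
smallest⇒excess≤0 c f zero _ _ T₁≤T₂ = contradiction
  (subst₂ _≤_ (T-one (suc c) (suc f) 1) (T-one c f 2) T₁≤T₂)
  (ℤ.<⇒≱ (ℤ.suc[i]≤j⇒i<j (by-nonneg (identity (+ c) (+ f)) (lit c ⊕ lit f ⊕ lit 1))))
  where
  identity : ∀ c f → (1ℤ + c) * (1ℤ + f) - 1ℤ - (1ℤ + (c * f - + 2)) ≡ c + f + 1ℤ
  identity = solve-∀
smallest⇒excess≤0 c f (suc k) j≤d c≤f T₁≤T₂ = ℤ.*-cancelʳ-≤-pos s 0ℤ P {{positive (ℤ.suc[i]≤j⇒i<j P≥1)}}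
  (ℤ.0≤i-j⇒j≤i (subst (0ℤ ≤_) D*x*[T₂-T₁] (lit d ⊗ lit e ⊗ (lit (suc c) ⊗ lit
      (suc f)) ⊗ ℤ.i≤j⇒0≤j-i T₁≤T₂)))
  where
  d = 2 ℕ.+ c
  e = 2 ℕ.+ f
  j = 2 ℕ.+ k
  J = + j
  s = excess d e j
  m = margin d e j
  W = w d e j
  D = + d * + e
  x = + suc c * + suc f
  T₁ = T (suc c) (suc f) 1 j
  T₂ = T c f 2 j
  P = J * (+ 2 + + c + + f) * W
  P≥1 : 1ℤ ≤ P
  P≥1 = J≥1 ⊛ size≥1 ⊛ (dCj≥1 ⊛ eCj≥1)
    where
    J≥1 : 1ℤ ≤ J
    J≥1 = +≤+ (ℕ.s≤s ℕ.z≤n)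
    size≥1 : 1ℤ ≤ + 2 + + c + + f
    size≥1 = +≤+ (ℕ.s≤s ℕ.z≤n)
    dCj≥1 : 1ℤ ≤ + (d C j)
    dCj≥1 = +≤+ (nCk>0 d j j≤d)
    eCj≥1 : 1ℤ ≤ + (e C j)
    eCj≥1 = +≤+ (nCk>0 e j (ℕ.≤-trans j≤d (ℕ.s≤s (ℕ.s≤s c≤f))))
  m-eq : m + + 2 * J ≡ + 3 + + c + + f
  m-eq = identity (+ c) (+ f) J
    where
    identity : ∀ c f J → + 2 + c + (+ 2 + f) - 1ℤ - + 2 * J + + 2 * J ≡ + 3 + c + f
    identity = solve-∀
  D*x*[T₂-T₁] : D * x * (T₂ - T₁) ≡ 0ℤ * P - s * P
  D*x*[T₂-T₁] = begin
    D * x * (T₂ - T₁)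
      ≡⟨ expand D x T₁ T₂ ⟩
    D * x * T₂ - x * (D * T₁)
      ≡⟨ cong₂ _-_ (D*x*T-two c f k) (cong (x *_) (D*T-one (suc c) (suc f) (suc k))) ⟩
    second s m J * W - x * ((s - J) * W)
      ≡⟨ cong (λ x → second s m J * W - x * ((s - J) * W)) (product-child (suc c) (suc f) (suc k)) ⟩
    second s m J * W - (s + (J - 1ℤ) * (m + + 2 * J)) * ((s - J) * W)
      ≡⟨ identity s m J W ⟩
    - (s * (J * (m + + 2 * J - 1ℤ) * W))
      ≡⟨ cong (λ N → - (s * (J * (N - 1ℤ) * W))) m-eq ⟩
    - (s * (J * (+ 3 + + c + + f - 1ℤ) * W))
      ≡⟨ collapse s J (+ c) (+ f) W ⟩
    0ℤ * P - s * P ∎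
    where
    open ≡-Reasoning
    expand : ∀ D x y z → D * x * (z - y) ≡ D * x * z - x * (D * y)
    expand = solve-∀
    identity : ∀ s m j W →
      ((s + j * (j - 1ℤ)) * (s + j * (j - 1ℤ) - m) - + 2 * (s + j * (j - 1ℤ)) * (j * j)
       + j * j * ((j - 1ℤ) * (j - 1ℤ))) * W - (s + (j - 1ℤ) * (m + + 2 * j)) * ((s - j) * W)
      ≡ - (s * (j * (m + + 2 * j - 1ℤ) * W))
    identity = solve-∀
    collapse : ∀ s J c f W → - (s * (J * (+ 3 + c + f - 1ℤ) * W))
      ≡ 0ℤ * (J * (+ 2 + c + f) * W) - s * (J * (+ 2 + c + f) * W)
    collapse = solve-∀

T-bounded : ∀ d e i j → d ℕ.≤ e → 1 ℕ.≤ j → j ℕ.≤ d → 1 ℕ.≤ i → i ℕ.≤ d → excess d e j ≤ 0ℤ →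
  + ∣ T (d ∸ i) (e ∸ i) i j ∣ ≤ - T (d ∸ 1) (e ∸ 1) 1 j
T-bounded d@(suc d′) e@(suc e′) i@(suc i′) j@(suc j′) d≤e _ j≤d _ i≤d s≤0 = ℤ.*-cancelʳ-≤-pos _ _ D
  (subst (+ ∣ Tᵢ ∣ * D ≤_) W≡
    (subst₂ (λ d e → + ∣ Tᵢ ∣ * (+ d * + e) ≤ w d e j * (+ j - excess d e j)) d≡ e≡
      (dominated (d ∸ i) (e ∸ i) (ℕ.∸-monoˡ-≤ i d≤e) i′ j′
        (subst (j ℕ.≤_) (sym d≡) j≤d)
        (subst₂ (λ d e → excess d e j ≤ 0ℤ) (sym d≡) (sym e≡) s≤0))))
  where
  D = + d * + e
  Tᵢ = T (d ∸ i) (e ∸ i) i j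
  d≡ = ℕ.m+[n∸m]≡n i≤d
  e≡ = ℕ.m+[n∸m]≡n (ℕ.≤-trans i≤d d≤e)
  W≡ : w d e j * (+ j - excess d e j) ≡ - T d′ e′ 1 j * D
  W≡ = trans (flip (excess d e j) (w d e j) (+ j))
      (trans (cong -_ (sym (D*T-one d′ e′ j′))) (neg D (T d′ e′ 1 j)))
    where
    flip : ∀ s W J → W * (J - s) ≡ - ((s - J) * W)
    flip = solve-∀
    neg : ∀ D t → - (D * t) ≡ - t * D
    neg = solve-∀

-∣i∣≤i : ∀ i → - (+ ∣ i ∣) ≤ i
-∣i∣≤i (+ zero)  = ℤ.≤-refl
-∣i∣≤i (+ suc n) = -≤+
-∣i∣≤i -[1+ n ]  = ℤ.≤-refl

theorem3p10 : (d n j : ℕ) → n ≥ 2 ℕ.* d → 0 ℕ.< j → j ℕ.≤ d →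
    let e = n ∸ d in
    (E₁-IsSmallest n d j ⇔ (j ℕ.* (n ∸ 1) ≥ d ℕ.* e))
    × (j ℕ.* (n ∸ 1) ≥ d ℕ.* e → E₁-IsSecondLargestInAbs n d j)
theorem3p10 d n j n≥2d j>0 j≤d = mk⇔ only-if if , second-largest
  where
  e = n ∸ d
  s = excess d e j

  d≤n : d ℕ.≤ n
  d≤n = ℕ.≤-trans (ℕ.m≤m+n d (d ℕ.+ 0)) n≥2d

  d≤e : d ℕ.≤ e
  d≤e = subst (ℕ._≤ e) (ℕ.m+n∸m≡n d d)
    (ℕ.∸-monoˡ-≤ d (subst (λ x → d ℕ.+ x ℕ.≤ n) (ℕ.+-identityʳ d) n≥2d))

  d>0 : 0 ℕ.< d
  d>0 = ℕ.<-≤-trans j>0 j≤d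

  n-1 : + (n ∸ 1) ≡ + d + + e - 1ℤ
  n-1 = trans (sym (ℤ.⊖-≥ (ℕ.≤-trans d>0 d≤n))) (cong (λ n → + n - 1ℤ) (sym (ℕ.m+[n∸m]≡n d≤n)))

  gap : + (d ℕ.* e) - + (j ℕ.* (n ∸ 1)) ≡ s
  gap = trans (cong₂ _-_ (pos-* d e) (trans (pos-* j (n ∸ 1)) (cong (+ j *_) n-1)))
      (identity (+ d) (+ e) (+ j))
    where
    identity : ∀ d e j → d * e - j * (d + e - 1ℤ) ≡ (d - j) * (e - j) - j * (j - 1ℤ)
    identity = solve-∀

  s≤0 : j ℕ.* (n ∸ 1) ≥ d ℕ.* e → s ≤ 0ℤ
  s≤0 de≤ = subst (_≤ 0ℤ) gap (ℤ.i≤j⇒i-j≤0 (+≤+ de≤))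

  s≤0⇒ : s ≤ 0ℤ → j ℕ.* (n ∸ 1) ≥ d ℕ.* e
  s≤0⇒ s≤0 = ℤ.drop‿+≤+ (ℤ.i-j≤0⇒i≤j (subst (_≤ 0ℤ) (sym gap) s≤0))

  bounded : j ℕ.* (n ∸ 1) ≥ d ℕ.* e → ∀ i → 1 ℕ.≤ i → i ℕ.≤ d → + ∣ E n d j i ∣ ≤ - E n d j 1
  bounded de≤ i 1≤i i≤d = subst₂ (λ x y → + ∣ x ∣ ≤ - y) (sym (E≡T n d j i)) (sym (E≡T n d j 1))
    (T-bounded d e i j d≤e j>0 j≤d 1≤i i≤d (s≤0 de≤))

  second-largest : j ℕ.* (n ∸ 1) ≥ d ℕ.* e → E₁-IsSecondLargestInAbs n d j
  second-largest de≤ i 1≤i i≤d = ℤ.drop‿+≤+ (subst (+ ∣ E n d j i ∣ ≤_)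
    (trans (sym (ℤ.0≤i⇒+∣i∣≡i (ℤ.≤-trans (lit ∣ E n d j i ∣) Eᵢ≤))) (cong +_ (ℤ.∣-i∣≡∣i∣ (E n d j 1)))) Eᵢ≤)
    where Eᵢ≤ = bounded de≤ i 1≤i i≤d

  if : j ℕ.* (n ∸ 1) ≥ d ℕ.* e → E₁-IsSmallest n d j
  -- For i = 0 the eigenvalue is the valency, while E_j(1) ≤ 0.
  if de≤ zero _ = ℤ.≤-trans E₁≤0 (subst (0ℤ ≤_) (sym (E≡T n d j 0)) (lit (d C j) ⊗ lit (e C j)))
    where
    E₁≤0 : E n d j 1 ≤ 0ℤ
    E₁≤0 = ℤ.neg-cancel-≤ (ℤ.≤-trans (lit ∣ E n d j 1 ∣) (bounded de≤ 1 ℕ.≤-refl d>0))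
  if de≤ i@(suc _) i≤d = ℤ.≤-trans
    (subst (_≤ - (+ ∣ E n d j i ∣)) (ℤ.neg-involutive (E n d j 1))
        (ℤ.neg-mono-≤ (bounded de≤ i (ℕ.s≤s ℕ.z≤n) i≤d)))
    (-∣i∣≤i (E n d j i))

  only-if : E₁-IsSmallest n d j → j ℕ.* (n ∸ 1) ≥ d ℕ.* e
  only-if smallest = s≤0⇒ (cases d e j d≤e j>0 j≤d λ 2≤d → subst₂ _≤_ (E≡T n d j 1) (E≡T n d j 2)
      (smallest 2 2≤d))
    where
    cases : ∀ d e j → d ℕ.≤ e → 0 ℕ.< j → j ℕ.≤ d →
      (2 ℕ.≤ d → T (d ∸ 1) (e ∸ 1) 1 j ≤ T (d ∸ 2) (e ∸ 2) 2 j) → excess d e j ≤ 0ℤ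
    -- For d = 1 there is no E_j(2) to compare with, but j = 1 and s = 0.
    cases 1 e 1 _ _ _ _ = ℤ.≤-refl
    cases 1 _ (suc (suc _)) _ _ (ℕ.s≤s ())
    cases (suc (suc c)) (suc (suc f)) (suc j) (ℕ.s≤s (ℕ.s≤s c≤f)) _ j≤d T₁≤T₂ =
      smallest⇒excess≤0 c f j j≤d c≤f (T₁≤T₂ (ℕ.s≤s (ℕ.s≤s ℕ.z≤n)))
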